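{- Let $d\ge2$ and $m\ge1$ be integers and suppose $A\subseteq\mathbb{Z}^m$ is $d$-sparse. If $A$ is stable in $(\mathbb{Z}^m,+)$, then $A$ is a finite Boolean combination of translates of finite sums of sets of the form $C(a;\delta)=\{a+d^\delta a+\cdots+d^{n\delta}a : n\in\mathbb{N}\}$, where $a\in\mathbb{Z}^m$ and $\delta$ is a positive integer.
   Context: For a finite string $k_0\cdots k_n$ of integers, $[k_0\cdots k_n]=\sum_i k_id^i$ (least significant digit first); for strings whose letters are column vectors in $\mathbb{Z}^m$, $[\cdot]$ is applied to each row, giving an element of $\mathbb{Z}^m$. Let $\Sigma=\{0,\ldots,d-1\}$ and $\Sigma_\pm=\{ -d+1,\ldots,d-1\}$. Canonical representation base $d$: of $0$ the empty word; of $a>0$ its usual base-$d$ digit string in $\Sigma^*$ written least significant digit first; of $a<0$ the word $(-k_0)\cdots(-k_n)$ where $k_0\cdots k_n$ is the canonical representation of $-a$; of $(a_1,\ldots,a_m)\in\mathbb{Z}^m$ the word over the alphabet $\Sigma_\pm^m$ whose $i$-th row is the canonical representation of $a_i$ padded with trailing zeros to the maximum length of the canonical representations of the $a_j$. A language $L$ over a finite alphabet is sparse if it is regular and the number of words of $L$ of length $\le k$ is bounded by a polynomial in $k$. $A\subseteq\mathbb{Z}^m$ is $d$-sparse if the set of canonical representations of its elements is a sparse language over $\Sigma_\pm^m$. An $N$-ladder for $R\subseteq X\times X$ is $a_0,\ldots,a_N,b_0,\ldots,b_N$ with $(a_i,b_j)\in R$ iff $i\le j$; $R$ is stable if some $N$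 admits no $N$-ladder. $A$ is stable in $(\mathbb{Z}^m,+)$ if $\{(x,y)\in(\mathbb{Z}^m)^2:x+y\in A\}$ is stable. -}

module Defs where

open import Data.Nat as ℕ using (ℕ; zero; suc; NonZero; _%_; _/_; _⊔_; >-nonZero⁻¹)
open import Data.Nat.DivMod using (m%n<n)
open import Data.Integer as ℤ using (ℤ; +_; -[1+_]; ∣_∣)
open import Data.Fin using (Fin; toℕ)
open import Data.Vec as Vec using (Vec)
open import Data.List as List using (List; []; _∷_; length; upTo; foldl)
open import Data.List.Relation.Unary.All using (All)
open import Data.List.Relation.Unary.Unique.Propositional using (Unique)
open import Data.Product using (Σ; ∃; ∃-syntax; _×_; _,_)
open import Data.Bool using (Bool; true)
open import Data.Sum using (_⊎_)
open import Relation.Binary.PropositionalEquality using (_≡_)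
open import Relation.Nullary using (¬_)

Point : ℕ → Set
Point m = Vec ℤ m

Subset : ℕ → Set₁
Subset m = Point m → Set

_⊕_ : ∀ {m} → Point m → Point m → Point m
_⊕_ = Vec.zipWith ℤ._+_

_·_ : ∀ {m} → ℤ → Point m → Point m
c · x = Vec.map (c ℤ.*_) x

𝟘 : ∀ {m} → Point m
𝟘 = Vec.replicate _ (+ 0)

SDigit : ℕ → Set
SDigit d = Σ ℤ (λ z → ∣ z ∣ ℕ.< d)

Letter : ℕ → ℕ → Set
Letter d m = Vec (SDigit d) m

Word : ℕ → ℕ → Set
Word d m = List (Letter d m)

Language : ℕ → ℕ → Set₁
Language d m = Word d m → Set

-- usual base-d digits of n, least significant first; fuel ≥ n suffices
digitsF : (d : ℕ) .{{_ : NonZero d}} → ℕ → ℕ → List (Σ ℕ (λ k → k ℕ.< d))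
digitsF d zero    n       = []
digitsF d (suc f) zero    = []
digitsF d (suc f) (suc n) = (suc n % d , m%n<n (suc n) d) ∷ digitsF d f (suc n / d)

digitsℕ : (d : ℕ) .{{_ : NonZero d}} → ℕ → List (Σ ℕ (λ k → k ℕ.< d))
digitsℕ d n = digitsF d n n

posD : ∀ {d} → Σ ℕ (λ k → k ℕ.< d) → SDigit d
posD (k , p) = (+ k , p)

negD : ∀ {d} → Σ ℕ (λ k → k ℕ.< d) → SDigit d
negD (zero  , p) = (+ 0 , p)
negD (suc k , p) = (-[1+ k ] , p)

canonℤ : (d : ℕ) .{{_ : NonZero d}} → ℤ → List (SDigit d)
canonℤ d (+ n)     = List.map posD (digitsℕ d n)
canonℤ d -[1+ n ]  = List.map negD (digitsℕ d (suc n))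

zeroD : (d : ℕ) .{{_ : NonZero d}} → SDigit d
zeroD d = (+ 0 , >-nonZero⁻¹ d)

nthOr : ∀ {A : Set} → A → List A → ℕ → A
nthOr z []       j       = z
nthOr z (x ∷ xs) zero    = x
nthOr z (x ∷ xs) (suc j) = nthOr z xs j

maxLen : ∀ {A : Set} {m} → Vec (List A) m → ℕ
maxLen rows = Vec.foldr _ (λ r acc → length r ⊔ acc) 0 rows

-- canonical representation of a point of ℤ^m: word over Σ_±^m whose
-- i-th row is the canonical representation of the i-th coordinate,
-- padded with trailing zeros to the maximum length
canon : (d : ℕ) .{{_ : NonZero d}} → ∀ {m} → Point m → Word d m
canon d x = List.map letterAt (upTo (maxLen rows))
  where
  rows = Vec.map (canonℤ d) x
  letterAt : ℕ → Letter d _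
  letterAt j = Vec.map (λ r → nthOr (zeroD d) r j) rows

record DFA (d m : ℕ) : Set where
  field
    nStates : ℕ
    start   : Fin nStates
    step    : Fin nStates → Letter d m → Fin nStates
    accept  : Fin nStates → Bool

Accepts : ∀ {d m} → DFA d m → Word d m → Set
Accepts M w = accept (foldl step start w) ≡ true
  where open DFA M

Regular : ∀ {d m} → Language d m → Set
Regular {d} {m} L =
  Σ (DFA d m) λ M → ∀ w → (L w → Accepts M w) × (Accepts M w → L w)

-- number of words of L of length ≤ k is at most c·(k+1)^e, phrased as:
-- every duplicate-free list of such words has length ≤ c·(k+1)^e
PolyBounded : ∀ {d m} → Language d m → Set
PolyBounded {d} {m} L =
  ∃[ c ] ∃[ e ] ∀ (k : ℕ) (ws : List (Word d m)) →
    Unique ws → All (λ w → L w × length w ℕ.≤ k) ws →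
    length ws ℕ.≤ c ℕ.* (suc k ℕ.^ e)

Sparse : ∀ {d m} → Language d m → Set
Sparse L = Regular L × PolyBounded L

CanonLang : (d : ℕ) .{{_ : NonZero d}} → ∀ {m} → Subset m → Language d m
CanonLang d A w = ∃[ x ] (A x × canon d x ≡ w)

DSparse : (d : ℕ) .{{_ : NonZero d}} → ∀ {m} → Subset m → Set
DSparse d A = Sparse (CanonLang d A)

Ladder : ∀ {X : Set} → (X → X → Set) → ℕ → Set
Ladder {X} R N =
  Σ (Fin (suc N) → X) λ a → Σ (Fin (suc N) → X) λ b →
    ∀ i j → (R (a i) (b j) → toℕ i ℕ.≤ toℕ j) × (toℕ i ℕ.≤ toℕ j → R (a i) (b j))

StableRel : ∀ {X : Set} → (X → X → Set) → Set
StableRel R = ∃[ N ] ¬ Ladder R N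

StableIn : ∀ {m} → Subset m → Set
StableIn A = StableRel (λ x y → A (x ⊕ y))

sumTo : ℕ → (ℕ → ℕ) → ℕ
sumTo zero    f = f 0
sumTo (suc n) f = sumTo n f ℕ.+ f (suc n)

C : (d : ℕ) → ∀ {m} → Point m → ℕ → Subset m
C d a δ x = ∃[ n ] x ≡ (+ sumTo n (λ i → d ℕ.^ (i ℕ.* δ))) · a

Gen : ℕ → Set
Gen m = Σ (Point m × ℕ) λ { (a , δ) → 1 ℕ.≤ δ }

SumC : (d : ℕ) → ∀ {m} → List (Gen m) → Subset m
SumC d []                   x = x ≡ 𝟘
SumC d (((a , δ) , _) ∷ gs) x = ∃[ y ] ∃[ z ] (C d a δ y × SumC d gs z × x ≡ y ⊕ z)

Translate : ∀ {m} → Point m → Subset m → Subset m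
Translate t S x = ∃[ s ] (S s × x ≡ t ⊕ s)

data BoolComb (m : ℕ) : Set where
  atom  : Point m → List (Gen m) → BoolComb m
  compl : BoolComb m → BoolComb m
  union : BoolComb m → BoolComb m → BoolComb m
  inter : BoolComb m → BoolComb m → BoolComb m

⟦_⟧ : ∀ {m} → BoolComb m → (d : ℕ) → Subset m
⟦ atom t gs ⟧ d x = Translate t (SumC d gs) x
⟦ compl e ⟧   d x = ¬ ⟦ e ⟧ d x
⟦ union e f ⟧ d x = ⟦ e ⟧ d x ⊎ ⟦ f ⟧ d x
⟦ inter e f ⟧ d x = ⟦ e ⟧ d x × ⟦ f ⟧ d x

{-# OPTIONS --safe #-}
-- Fix an automaton for A.  Write R(n) = 1 + D + ⋯ + Dⁿ⁻¹ with D = dᵟ, where δ is a common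
-- multiple of the lengths of its simple loops, and let L be a common multiple of the periods
-- of self-maps of the square of its state set.  Two loops of equal length at a useful state
-- coincide by sparsity, so A is covered by finitely many families
-- { t + ∑ aᵢ R(L nᵢ) : nᵢ ≥ 1 }, each of which is a translate of a sum of sets C(R(L) aᵢ; δL).
--
-- While the automaton reads the digits of t + ∑ aᵢ R(L nᵢ), for nᵢ in a given order and far
-- apart, the carry between consecutive places becomes constant and the state becomes periodic
-- with period dividing L; hence acceptance depends on the order of the nᵢ only.  A change of
-- the answer under an adjacent transposition would produce ladders, so by stability it does
-- not depend on the order either.  The points of the family for which the nᵢ are not far
-- apart lie in finitely many families with fewer parameters, and induction on the number of
-- parameters shows that A agrees with a Boolean combination on every family.
module Submission where

open import Defs
open import Data.Bool using (Bool; true; false; if_then_else_)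
import Data.Bool.Properties as BoolP
open import Data.Fin as Fin using (Fin; toℕ)
import Data.Fin.Properties as FinP
open import Data.Integer as ℤ using (ℤ; +_; -[1+_]; ∣_∣; _/ℕ_; _%ℕ_; _+_; _*_; -_; _◃_; sign)
open import Data.Integer.DivMod using (n%ℕd<d; a≡a%ℕn+[a/ℕn]*n; [n/ℕd]*d≤n; n<s[n/ℕd]*d)
import Data.Integer.Properties as ℤP
open import Data.Integer.Tactic.RingSolver using (solve-∀)
open import Data.List as List using (List; []; _∷_; _++_; length; upTo; applyUpTo; concatMap; foldl; cartesianProductWith; allFin; take; drop)
open import Data.List.Extrema.Nat using (max; xs≤max)
open import Data.List.Membership.Propositional using (_∈_; _∉_; lose; find)
import Data.List.Membership.Propositional.Properties as ∈P
import Data.List.Properties as ListP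
open import Data.List.Relation.Binary.Permutation.Propositional as ↭ using (_↭_; prep; swap; ↭-refl; ↭-trans)
import Data.List.Relation.Binary.Permutation.Propositional.Properties as ↭P
open import Data.List.Relation.Unary.All as All using (All; []; _∷_)
import Data.List.Relation.Unary.All.Properties as AllP
open import Data.List.Relation.Unary.AllPairs using ([]; _∷_)
open import Data.List.Relation.Unary.Any as Any using (here; there; any?)
open import Data.List.Relation.Unary.Unique.Propositional using (Unique)
import Data.List.Relation.Unary.Unique.Propositional.Properties as UniqueP
open import Data.Nat as ℕ using (ℕ; zero; suc; NonZero; s≤s; z≤n; _!)
open import Data.Nat.Divisibility using (_∣_; divides; m≤n⇒m!∣n!; ∣-trans; m∣m*n)
import Data.Nat.DivMod as ℕD
open import Data.Nat.GeneralisedArithmetic using (iterate)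
import Data.Nat.Properties as ℕP
import Data.Nat.Tactic.RingSolver as ℕSolver
open import Data.Product as Prod using (Σ; ∃-syntax; _×_; _,_; proj₁; proj₂)
open import Data.Sign as Sign using (Sign)
open import Data.Sum using (_⊎_; inj₁; inj₂; [_,_]′)
open import Data.Unit using (⊤; tt)
open import Data.Vec as Vec using (Vec; []; _∷_)
import Data.Vec.Properties as VecP
open import Data.Vec.Relation.Unary.All as VAll using ([]; _∷_)
open import Function using (_∘_; mk⇔)
open import Relation.Binary.Definitions using (DecidableEquality)
open import Relation.Binary.PropositionalEquality
open import Relation.Nullary using (¬_; Dec; does; yes; no; contradiction)
open import Relation.Nullary.Decidable using (dec-true; dec-false; decidable-stable; map′; _×-dec_)
import Algebra.Properties.Group
open import Algebra.Bundles using (AbelianGroup)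

private module +-Group = Algebra.Properties.Group (AbelianGroup.group ℤP.+-0-abelianGroup)

-- Two mismatches shape the development. The coefficients `aᵢ` have mixed signs, so the digits of a
-- point of a family need not be those of any word that it was built from. Carries are easy to
-- follow for floor division, which commutes with adding multiples of d, whereas canonical digits
-- are truncated towards zero. But floor division preserves signs. So each sum is read twice: once
-- to learn its sign vector from the quotient that is left over, and once more with these signs
-- removed. The other mismatch is that a canonical word stops at its last nonzero letter while
-- repeated division never stops. A second state therefore remembers where the automaton stood at
-- that letter, and this is why L has to serve self-maps of the square of the state set. The
-- families cover A but may also contain points outside of it, because coefficients and translates
-- are collected generously. Hence the automaton is consulted again on every family, and stability
-- acts on its answers there.

iterate-+ : ∀ {A : Set} (f : A → A) x m n → iterate f x (m ℕ.+ n) ≡ iterate f (iterate f x m) n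
iterate-+ f x zero    n = refl
iterate-+ f x (suc m) n = iterate-+ f (f x) m n

iterate-fixed : ∀ {A : Set} (f : A → A) {x} → f x ≡ x → ∀ n → iterate f x n ≡ x
iterate-fixed f p zero    = refl
iterate-fixed f p (suc n) = trans (cong (λ y → iterate f y n) p) (iterate-fixed f p n)

-- Iterated floor division

module _ (d : ℕ) .{{_ : NonZero d}} where

  open import Data.Integer using (_≤_; _<_)

  *-cancelʳ-<-suc : ∀ {q r} → q * + d < ℤ.suc r * + d → q ≤ r
  *-cancelʳ-<-suc {q} {r} p = subst (q ≤_) (ℤP.pred-suc r) (ℤP.i<j⇒i≤pred[j] (ℤP.*-cancelʳ-<-nonNeg {q} {ℤ.suc r} (+ d) p))

  /ℕ-mono : ∀ {x y} → x ≤ y → x /ℕ d ≤ y /ℕ d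
  /ℕ-mono {x} {y} p = *-cancelʳ-<-suc (ℤP.≤-<-trans ([n/ℕd]*d≤n x d) (ℤP.≤-<-trans p (n<s[n/ℕd]*d y d)))

  /ℕ-unique : ∀ {x q} → q * + d ≤ x → x < ℤ.suc q * + d → x /ℕ d ≡ q
  /ℕ-unique {x} p p' = ℤP.≤-antisym (*-cancelʳ-<-suc (ℤP.≤-<-trans ([n/ℕd]*d≤n x d) p'))
                                    (*-cancelʳ-<-suc (ℤP.≤-<-trans p (n<s[n/ℕd]*d x d)))

  -- True for all signs of `x` and `y`, and false for truncated division; this is why carries are
  -- computed with floors.
  +*-/ℕ : ∀ x y → (x + + d * y) /ℕ d ≡ x /ℕ d + y
  +*-/ℕ x y = /ℕ-unique
    (subst (_≤ x + + d * y) (sym (e₁ (x /ℕ d) y (+ d))) (ℤP.+-monoˡ-≤ (+ d * y) ([n/ℕd]*d≤n x d)))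
    (subst (x + + d * y <_) (sym (e₂ (x /ℕ d) y (+ d))) (ℤP.+-monoˡ-< (+ d * y) (n<s[n/ℕd]*d x d)))
    where
    e₁ : ∀ q y d → (q + y) * d ≡ q * d + d * y
    e₁ = solve-∀
    e₂ : ∀ q y d → (+ 1 + (q + y)) * d ≡ (+ 1 + q) * d + d * y
    e₂ = solve-∀

  +*-%ℕ : ∀ x y → (x + + d * y) %ℕ d ≡ x %ℕ d
  +*-%ℕ x y = ℤP.+-injective (+-Group.∙-cancelʳ ((x /ℕ d + y) * + d) _ _ (begin
    + (z %ℕ d) + (x /ℕ d + y) * + d   ≡⟨ cong (λ q → + (z %ℕ d) + q * + d) (+*-/ℕ x y) ⟨
    + (z %ℕ d) + z /ℕ d * + d         ≡⟨ a≡a%ℕn+[a/ℕn]*n z d ⟨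
    x + + d * y                       ≡⟨ cong (_+ + d * y) (a≡a%ℕn+[a/ℕn]*n x d) ⟩
    + (x %ℕ d) + x /ℕ d * + d + + d * y ≡⟨ e (+ (x %ℕ d)) (x /ℕ d) (+ d) y ⟩
    + (x %ℕ d) + (x /ℕ d + y) * + d   ∎))
    where
    open ≡-Reasoning
    z = x + + d * y
    e : ∀ r q d y → r + q * d + d * y ≡ r + (q + y) * d
    e = solve-∀

  *-/ℕ : ∀ y → (+ d * y) /ℕ d ≡ y
  *-/ℕ y = begin
    (+ d * y) /ℕ d          ≡⟨ cong (_/ℕ d) (ℤP.+-identityˡ (+ d * y)) ⟨
    (+ 0 + + d * y) /ℕ d    ≡⟨ +*-/ℕ (+ 0) y ⟩
    (+ 0) /ℕ d + y          ≡⟨ cong (_+ y) (/ℕ-unique {q = + 0} (ℤP.≤-refl) (ℤP.positive⁻¹ _ {{pos}})) ⟩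
    + 0 + y                 ≡⟨ ℤP.+-identityˡ y ⟩
    y ∎
    where
    open ≡-Reasoning
    pos : ℤ.Positive ((ℤ.suc (+ 0)) * + d)
    pos = subst ℤ.Positive (sym (ℤP.*-identityˡ (+ d))) (ℤ.positive (ℤ.+<+ (ℕ.>-nonZero⁻¹ d)))

  floors : ℕ → ℤ → ℤ
  floors k x = iterate (_/ℕ d) x k

  floors-mono : ∀ k {x y} → x ≤ y → floors k x ≤ floors k y
  floors-mono zero    p = p
  floors-mono (suc k) p = floors-mono k (/ℕ-mono p)

  floors-neg : ∀ k {x} → x < + 0 → floors k x < + 0
  floors-neg zero    p = p
  floors-neg (suc k) {x} p = floors-neg k (ℤP.*-cancelʳ-<-nonNeg {x /ℕ d} {+ 0} (+ d)
    (ℤP.≤-<-trans ([n/ℕd]*d≤n x d) p))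

  module _ (2≤d : 2 ℕ.≤ d) where

    2M≤dM : ∀ M → + M + + M ≤ + d * + M
    2M≤dM M = subst (+ M + + M ≤_) (ℤP.pos-* d M)
      (ℤ.+≤+ (ℕP.≤-trans (ℕP.≤-reflexive (cong (M ℕ.+_) (sym (ℕP.+-identityʳ M)))) (ℕP.*-monoˡ-≤ M 2≤d)))

    M≤dM : ∀ M → + M ≤ + d * + M
    M≤dM M = ℤP.≤-trans (ℤP.i≤i+j (+ M) (+ M)) (2M≤dM M)

    floors-≤ : ∀ k M → floors k (+ M) ≤ + M
    floors-≤ zero    M = ℤP.≤-refl
    floors-≤ (suc k) M = ℤP.≤-trans
      (floors-mono k (ℤP.≤-trans (/ℕ-mono (M≤dM M)) (ℤP.≤-reflexive (*-/ℕ (+ M))))) (floors-≤ k M)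

    floors-≥ : ∀ k M → - + M ≤ floors k (- + M)
    floors-≥ zero    M = ℤP.≤-refl
    floors-≥ (suc k) M = ℤP.≤-trans (floors-≥ k M) (floors-mono k
      (ℤP.≤-trans (ℤP.≤-reflexive (sym (*-/ℕ (- + M)))) (/ℕ-mono
        (subst (_≤ - + M) (ℤP.neg-distribʳ-* (+ d) (+ M)) (ℤP.neg-mono-≤ (M≤dM M))))))

    -- The map below is monotone and maps [-M, M] into itself once |b| ≤ M, so its
    -- orbits are monotone and bounded, hence eventually constant.
    module _ (k : ℕ) (b : ℤ) where

      private
        i≤∣i∣ : ∀ i → i ≤ + ∣ i ∣
        i≤∣i∣ (+ _)    = ℤP.≤-refl
        i≤∣i∣ -[1+ _ ] = ℤ.-≤+

        i≤ : ∀ i {M} → ∣ i ∣ ℕ.≤ M → i ≤ + M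
        i≤ i p = ℤP.≤-trans (i≤∣i∣ i) (ℤ.+≤+ p)

        ≤i : ∀ i {M} → ∣ i ∣ ℕ.≤ M → - + M ≤ i
        ≤i i {M} p = subst (- + M ≤_) (ℤP.neg-involutive i)
          (ℤP.neg-mono-≤ (i≤ (- i) (subst (ℕ._≤ M) (sym (ℤP.∣-i∣≡∣i∣ i)) p)))

        f : ℤ → ℤ
        f t = floors (suc k) (t + b)

        f-mono : ∀ {x y} → x ≤ y → f x ≤ f y
        f-mono p = floors-mono (suc k) (ℤP.+-monoˡ-≤ b p)

        f-≤ : ∀ M {t} → b ≤ + M → t ≤ + M → f t ≤ + M
        f-≤ M p q = ℤP.≤-trans (floors-mono k (ℤP.≤-trans
            (/ℕ-mono (ℤP.≤-trans (ℤP.+-mono-≤ q p) (2M≤dM M))) (ℤP.≤-reflexive (*-/ℕ (+ M)))))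
          (floors-≤ k M)

        f-≥ : ∀ M {t} → - + M ≤ b → - + M ≤ t → - + M ≤ f t
        f-≥ M p q = ℤP.≤-trans (floors-≥ k M) (floors-mono k
          (ℤP.≤-trans (ℤP.≤-reflexive (sym (*-/ℕ (- + M)))) (/ℕ-mono (ℤP.≤-trans
            (subst₂ _≤_ (ℤP.neg-distribʳ-* (+ d) (+ M)) (ℤP.neg-distrib-+ (+ M) (+ M)) (ℤP.neg-mono-≤ (2M≤dM M)))
            (ℤP.+-mono-≤ q p)))))

        -- `j` is fuel: it bounds the room between `t` and `M`, and every strict step of the orbit
        -- uses up at least 1 of it.
        up : ∀ M → b ≤ + M → ∀ j {t} → t ≤ f t → t ≤ + M → + M ≤ t + + j →
             ∃[ n ] f (iterate f t n) ≡ iterate f t n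
        up M b≤M zero {t} t≤ft t≤M M≤ = 0 , ℤP.≤-antisym
          (ℤP.≤-trans (f-≤ M b≤M t≤M) (subst (+ M ≤_) (ℤP.+-identityʳ t) M≤)) t≤ft
        up M b≤M (suc j) {t} t≤ft t≤M M≤ with f t ℤP.≟ t
        ... | yes p = 0 , p
        ... | no ¬p with up M b≤M j (f-mono t≤ft) (f-≤ M b≤M t≤M)
                       (ℤP.≤-trans M≤ (subst (_≤ f t + + j) (e t (+ j))
                         (ℤP.+-monoˡ-≤ (+ j) (ℤP.i<j⇒suc[i]≤j (ℤP.≤∧≢⇒< t≤ft (λ q → ¬p (sym q)))))))
          where
          e : ∀ t j → (+ 1 + t) + j ≡ t + (+ 1 + j)
          e = solve-∀
        ...   | n , q = suc n , q

        down : ∀ M → - + M ≤ b → ∀ j {t} → f t ≤ t → - + M ≤ t → t ≤ - + M + + j →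
               ∃[ n ] f (iterate f t n) ≡ iterate f t n
        down M b≥ zero {t} ft≤t t≥ t≤ = 0 , ℤP.≤-antisym ft≤t
          (ℤP.≤-trans (subst (t ≤_) (ℤP.+-identityʳ _) t≤) (f-≥ M b≥ t≥))
        down M b≥ (suc j) {t} ft≤t t≥ t≤ with f t ℤP.≟ t
        ... | yes p = 0 , p
        ... | no ¬p with down M b≥ j (f-mono ft≤t) (f-≥ M b≥ t≥)
                       (ℤP.≤-trans (ℤP.i<j⇒i≤pred[j] (ℤP.≤∧≢⇒< ft≤t ¬p))
                         (subst (ℤ.pred t ≤_) (e (- + M) (+ j)) (ℤP.pred-mono t≤)))
          where
          e : ∀ t j → (- + 1) + (t + (+ 1 + j)) ≡ t + j
          e = solve-∀
        ...   | n , q = suc n , q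

      private
        bound : ℤ → ℕ
        bound t = ∣ t ∣ ℕ.+ ∣ b ∣

      floors-stabilise : ∀ t → ∃[ n ] f (iterate f t n) ≡ iterate f t n
      floors-stabilise t with ℤP.≤-total t (f t)
      -- `M` bounds both |t| and |b|, and M + M is the width of [-M, M], so it is enough fuel.
      ... | inj₁ p = up M (i≤ b ∣b∣≤M) (M ℕ.+ M) p (i≤ t ∣t∣≤M)
                       (subst (_≤ t + (+ M + + M)) (e (+ M)) (ℤP.+-monoˡ-≤ (+ M + + M) (≤i t ∣t∣≤M)))
        where
        M = bound t
        ∣t∣≤M = ℕP.m≤m+n ∣ t ∣ ∣ b ∣
        ∣b∣≤M = ℕP.m≤n+m ∣ b ∣ ∣ t ∣
        e : ∀ M → - M + (M + M) ≡ M
        e = solve-∀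
      ... | inj₂ p = down M (≤i b ∣b∣≤M) (M ℕ.+ M) p (≤i t ∣t∣≤M)
                       (ℤP.≤-trans (i≤ t ∣t∣≤M) (ℤP.≤-reflexive (e (+ M))))
        where
        M = bound t
        ∣t∣≤M = ℕP.m≤m+n ∣ t ∣ ∣ b ∣
        ∣b∣≤M = ℕP.m≤n+m ∣ b ∣ ∣ t ∣
        e : ∀ M → M ≡ - M + (M + M)
        e = solve-∀

-- Reading digits with carries

Point₀-unique : (x y : Point 0) → x ≡ y
Point₀-unique [] [] = refl

·-· : ∀ {m} a b (x : Point m) → (a * b) · x ≡ a · (b · x)
·-· a b []       = refl
·-· a b (x ∷ xs) = cong₂ _∷_ (ℤP.*-assoc a b x) (·-· a b xs)

⊕-identityʳ : ∀ {m} (x : Point m) → x ⊕ 𝟘 ≡ x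
⊕-identityʳ []       = refl
⊕-identityʳ (x ∷ xs) = cong₂ _∷_ (ℤP.+-identityʳ x) (⊕-identityʳ xs)

sumP : ∀ {m} → List (Point m) → Point m
sumP = List.foldr _⊕_ 𝟘

module _ {d : ℕ} where

  signed : Sign → Σ ℕ (ℕ._< d) → SDigit d
  signed Sign.+ = posD
  signed Sign.- = negD

  signed-cong : ∀ s {k l} {p : k ℕ.< d} {q : l ℕ.< d} → k ≡ l → signed s (k , p) ≡ signed s (l , q)
  signed-cong s {k} refl = cong (λ p → signed s (k , p)) (ℕP.<-irrelevant _ _)

module _ (d : ℕ) .{{_ : NonZero d}} where

  digit : Sign → ℤ → SDigit d
  digit s z = signed s (z %ℕ d , n%ℕd<d z d)

  letter : ∀ {m} → Vec Sign m → Point m → Letter d m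
  letter = Vec.zipWith digit

  letter-shift : ∀ {m} (σ : Vec Sign m) z y → letter σ (z ⊕ ((+ d) · y)) ≡ letter σ z
  letter-shift []      []      []      = refl
  letter-shift (s ∷ σ) (z ∷ zs) (y ∷ ys) = cong₂ _∷_ (signed-cong s (+*-%ℕ d z y)) (letter-shift σ zs ys)

  floor : ∀ {m} → Point m → Point m
  floor = Vec.map (_/ℕ d)

  floor-shift : ∀ {m} (z y : Point m) → floor (z ⊕ ((+ d) · y)) ≡ floor z ⊕ y
  floor-shift []       []       = refl
  floor-shift (z ∷ zs) (y ∷ ys) = cong₂ _∷_ (+*-/ℕ d z y) (floor-shift zs ys)

  floorⁿ : ∀ {m} → ℕ → Point m → Point m
  floorⁿ k z = iterate floor z k

  floorⁿ-∷ : ∀ {m} k z (zs : Point m) → floorⁿ k (z ∷ zs) ≡ floors d k z ∷ floorⁿ k zs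
  floorⁿ-∷ zero    z zs = refl
  floorⁿ-∷ (suc k) z zs = floorⁿ-∷ k (z /ℕ d) (floor zs)

  pow-suc : ∀ {m} k (y : Point m) → (+ (d ℕ.^ suc k)) · y ≡ (+ d) · ((+ (d ℕ.^ k)) · y)
  pow-suc k y = trans (cong (_· y) (ℤP.pos-* d (d ℕ.^ k))) (·-· (+ d) (+ (d ℕ.^ k)) y)

  floorⁿ-shift : ∀ {m} k (z y : Point m) → floorⁿ k (z ⊕ ((+ (d ℕ.^ k)) · y)) ≡ floorⁿ k z ⊕ y
  floorⁿ-shift zero    z y = cong (z ⊕_) (trans (VecP.map-cong ℤP.*-identityˡ y) (VecP.map-id y))
  floorⁿ-shift (suc k) z y = begin
    floorⁿ k (floor (z ⊕ ((+ (d ℕ.^ suc k)) · y)))         ≡⟨ cong (λ w → floorⁿ k (floor (z ⊕ w))) (pow-suc k y) ⟩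
    floorⁿ k (floor (z ⊕ ((+ d) · ((+ (d ℕ.^ k)) · y))))   ≡⟨ cong (floorⁿ k) (floor-shift z _) ⟩
    floorⁿ k (floor z ⊕ ((+ (d ℕ.^ k)) · y))               ≡⟨ floorⁿ-shift k (floor z) y ⟩
    floorⁿ k (floor z) ⊕ y                                 ∎
    where open ≡-Reasoning

  -- Digits come from floor division; canonical representations are truncated instead, so they
  -- are read off the nonnegative point obtained by removing the signs σ.
  module _ {m : ℕ} {S : Set} (step : S → Letter d m → S) (σ : Vec Sign m) where

    run : ℕ → S → Point m → S
    run zero    Q z = Q
    run (suc k) Q z = run k (step Q (letter σ z)) (floor z)

    run-+ : ∀ j k Q z → run (j ℕ.+ k) Q z ≡ run k (run j Q z) (floorⁿ j z)
    run-+ zero    k Q z = refl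
    run-+ (suc j) k Q z = run-+ j k (step Q (letter σ z)) (floor z)

    run-shift : ∀ k Q z y → run k Q (z ⊕ ((+ (d ℕ.^ k)) · y)) ≡ run k Q z
    run-shift zero    Q z y = refl
    run-shift (suc k) Q z y = begin
      run (suc k) Q (z ⊕ ((+ (d ℕ.^ suc k)) · y))        ≡⟨ cong (λ w → run (suc k) Q (z ⊕ w)) (pow-suc k y) ⟩
      run k (step Q (letter σ z′)) (floor z′)            ≡⟨ cong₂ (λ ℓ w → run k (step Q ℓ) w) (letter-shift σ z _) (floor-shift z _) ⟩
      run k (step Q (letter σ z)) (floor z ⊕ ((+ (d ℕ.^ k)) · y)) ≡⟨ run-shift k _ (floor z) y ⟩
      run k (step Q (letter σ z)) (floor z)              ∎
      where
      open ≡-Reasoning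
      z′ = z ⊕ ((+ d) · ((+ (d ℕ.^ k)) · y))

  module _ (δ′ : ℕ) where

    private
      δ : ℕ
      δ = suc δ′
      D : ℤ
      D = + (d ℕ.^ δ)

    repunit : ℕ → ℤ
    repunit zero    = + 0
    repunit (suc n) = + 1 + D * repunit n

    repunit-+ : ∀ j k → repunit (j ℕ.+ k) ≡ repunit j + D ℤ.^ j * repunit k
    repunit-+ zero    k = sym (trans (ℤP.+-identityˡ _) (ℤP.*-identityˡ _))
    repunit-+ (suc j) k = trans (cong (λ r → + 1 + D * r) (repunit-+ j k)) (e D (repunit j) (D ℤ.^ j) (repunit k))
      where
      e : ∀ D r p s → + 1 + D * (r + p * s) ≡ + 1 + D * r + D * p * s
      e = solve-∀

    module _ {m : ℕ} {S : Set} (step : S → Letter d m → S) (σ : Vec Sign m) where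

      block : S × Point m → S × Point m
      block (Q , z) = run step σ δ Q z , floorⁿ δ z

      block-iterate : ∀ n Q z → iterate block (Q , z) n ≡ (run step σ (n ℕ.* δ) Q z , floorⁿ (n ℕ.* δ) z)
      block-iterate zero    Q z = refl
      block-iterate (suc n) Q z = trans (block-iterate n _ _) (cong₂ _,_
        (sym (run-+ step σ δ (n ℕ.* δ) Q z)) (sym (iterate-+ floor z δ (n ℕ.* δ))))

      carry : Point m → S × Point m → S × Point m
      carry b (Q , t) = block (Q , t ⊕ b)

      -- Reading n blocks of t + b(1 + D + ⋯ + Dⁿ⁻¹) + Dⁿ y does not see y, and the
      -- quotient that is left is a carry determined by t and b, plus y.
      block-carry : ∀ n Q t b y → iterate block (Q , (t ⊕ ((repunit n · b) ⊕ ((D ℤ.^ n) · y)))) n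
                                ≡ Prod.map₂ (_⊕ y) (iterate (carry b) (Q , t) n)
      block-carry zero    Q t b y = cong (Q ,_) (e t b y)
        where
        e : ∀ {m} (t b y : Point m) → t ⊕ (((+ 0) · b) ⊕ ((+ 1) · y)) ≡ t ⊕ y
        e []       []       []       = refl
        e (t ∷ ts) (b ∷ bs) (y ∷ ys) = cong₂ _∷_ (eℤ t b y) (e ts bs ys)
          where
          eℤ : ∀ t b y → t + (+ 0 * b + + 1 * y) ≡ t + y
          eℤ = solve-∀
      block-carry (suc n) Q t b y = begin
        iterate block (block (Q , (t ⊕ (((+ 1 + D * r) · b) ⊕ ((D * p) · y))))) n
          ≡⟨ cong (λ w → iterate block (block (Q , w)) n) (e t b y) ⟩
        iterate block (block (Q , (t ⊕ b) ⊕ (D · x))) n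
          ≡⟨ cong₂ (λ q w → iterate block (q , w) n) (run-shift step σ δ Q (t ⊕ b) x) (floorⁿ-shift δ (t ⊕ b) x) ⟩
        iterate block (run step σ δ Q (t ⊕ b) , floorⁿ δ (t ⊕ b) ⊕ x) n
          ≡⟨ block-carry n _ _ b y ⟩
        Prod.map₂ (_⊕ y) (iterate (carry b) (carry b (Q , t)) n) ∎
        where
        open ≡-Reasoning
        r = repunit n
        p = D ℤ.^ n
        x = (r · b) ⊕ (p · y)
        e : ∀ {m} (t b y : Point m) → t ⊕ (((+ 1 + D * r) · b) ⊕ ((D * p) · y)) ≡ (t ⊕ b) ⊕ (D · ((r · b) ⊕ (p · y)))
        e []       []       []       = refl
        e (t ∷ ts) (b ∷ bs) (y ∷ ys) = cong₂ _∷_ (eℤ D r p t b y) (e ts bs ys)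
          where
          eℤ : ∀ D r p t b y → t + ((+ 1 + D * r) * b + (D * p) * y) ≡ (t + b) + D * (r * b + p * y)
          eℤ = solve-∀

    floorⁿ-stabilise : 2 ℕ.≤ d → ∀ {m} (b t : Point m) → let f = λ t → floorⁿ δ (t ⊕ b) in
      ∃[ T ] (∀ n → T ℕ.≤ n → f (iterate f t n) ≡ iterate f t n)
    floorⁿ-stabilise 2≤d []       []       = 0 , λ n _ → Point₀-unique _ _
    floorⁿ-stabilise 2≤d (b ∷ bs) (t ∷ ts) with floors-stabilise d 2≤d δ′ b t | floorⁿ-stabilise 2≤d bs ts
    ... | N , fixed | T , fixeds = N ℕ.⊔ T , λ n p → begin
      F (iterate F (t ∷ ts) n)                  ≡⟨ cong F (split n t ts) ⟩
      F (iterate f t n ∷ iterate fs ts n)       ≡⟨ floorⁿ-∷ δ (iterate f t n + b) (iterate fs ts n ⊕ bs) ⟩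
      f (iterate f t n) ∷ fs (iterate fs ts n)  ≡⟨ cong₂ _∷_ (later n (ℕP.≤-trans (ℕP.m≤m⊔n N T) p)) (fixeds n (ℕP.≤-trans (ℕP.m≤n⊔m N T) p)) ⟩
      iterate f t n ∷ iterate fs ts n           ≡⟨ split n t ts ⟨
      iterate F (t ∷ ts) n                      ∎
      where
      open ≡-Reasoning
      f  = λ t → floors d δ (t + b)
      fs = λ ts → floorⁿ δ (ts ⊕ bs)
      F  = λ t → floorⁿ δ (t ⊕ (b ∷ bs))
      split : ∀ n t ts → iterate F (t ∷ ts) n ≡ iterate f t n ∷ iterate fs ts n
      split zero    t ts = refl
      split (suc n) t ts = trans (cong (λ v → iterate F v n) (floorⁿ-∷ δ (t + b) (ts ⊕ bs))) (split n (f t) (fs ts))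
      later : ∀ n → N ℕ.≤ n → f (iterate f t n) ≡ iterate f t n
      later n p = begin
        f (iterate f t n)                         ≡⟨ cong f eq ⟩
        f (iterate f t N)                         ≡⟨ fixed ⟩
        iterate f t N                             ≡⟨ eq ⟨
        iterate f t n                             ∎
        where
        eq : iterate f t n ≡ iterate f t N
        eq = trans (cong (iterate f t) (sym (ℕP.m+[n∸m]≡n p)))
             (trans (iterate-+ f t N (n ℕ.∸ N)) (iterate-fixed f fixed (n ℕ.∸ N)))

    module _ (L : ℕ) {m : ℕ} where

      -- ∑ aᵢ R(L pᵢ) for the places p₁ = g₁, p₂ = g₁ + g₂, …, in Horner form.
      gapSum : List (Point m × ℕ) → Point m
      gapSum []             = 𝟘
      gapSum ((a , g) ∷ gs) = (repunit (L ℕ.* g) · (a ⊕ sumP (List.map proj₁ gs))) ⊕ ((D ℤ.^ (L ℕ.* g)) · gapSum gs)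

      gapLength : List (Point m × ℕ) → ℕ
      gapLength []             = 0
      gapLength ((a , g) ∷ gs) = L ℕ.* g ℕ.+ gapLength gs

      module _ (2≤d : 2 ℕ.≤ d) (1≤L : 1 ℕ.≤ L) {S : Set} (step : S → Letter d m → S) (M : ℕ)
        (periodic : ∀ (φ : S → S) Q n → M ℕ.≤ n → iterate φ Q (n ℕ.+ L) ≡ iterate φ Q n)
        (σ : Vec Sign m) where

        carry-periodic : ∀ b Q t → ∃[ T ] (∀ n → T ℕ.≤ n →
          iterate (carry step σ b) (Q , t) (n ℕ.+ L) ≡ iterate (carry step σ b) (Q , t) n)
        carry-periodic b Q t with floorⁿ-stabilise 2≤d b t
        -- After `T` steps the carry rests at `t₀`, and from then on the state moves by the single
        -- self-map `φ`, which needs `M` more steps to enter its cycle.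
        ... | T , fixed = M ℕ.+ T , λ n p → begin
          iterate Φ (Q , t) (n ℕ.+ L)                   ≡⟨ at (n ℕ.+ L) (ℕP.≤-trans (ℕP.m+n≤o⇒n≤o M p) (ℕP.m≤m+n n L)) ⟩
          (iterate φ Q₀ ((n ℕ.+ L) ℕ.∸ T) , t₀)         ≡⟨ cong (λ k → iterate φ Q₀ k , t₀) (ℕP.+-∸-comm L (ℕP.m+n≤o⇒n≤o M p)) ⟩
          (iterate φ Q₀ ((n ℕ.∸ T) ℕ.+ L) , t₀)         ≡⟨ cong (_, t₀) (periodic φ Q₀ (n ℕ.∸ T) (ℕP.m+n≤o⇒m≤o∸n M p)) ⟩
          (iterate φ Q₀ (n ℕ.∸ T) , t₀)                 ≡⟨ at n (ℕP.m+n≤o⇒n≤o M p) ⟨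
          iterate Φ (Q , t) n                           ∎
          where
          open ≡-Reasoning
          Φ = carry step σ b
          f = λ t → floorⁿ δ (t ⊕ b)
          t₀ = iterate f t T
          Q₀ = proj₁ (iterate Φ (Q , t) T)
          φ = λ Q → run step σ δ Q (t₀ ⊕ b)
          second : ∀ n Q t → proj₂ (iterate Φ (Q , t) n) ≡ iterate f t n
          second zero    Q t = refl
          second (suc n) Q t = second n _ _
          from-t₀ : ∀ k Q → iterate Φ (Q , t₀) k ≡ (iterate φ Q k , t₀)
          from-t₀ zero    Q = refl
          from-t₀ (suc k) Q = trans (cong (λ w → iterate Φ (φ Q , w) k) (fixed T ℕP.≤-refl)) (from-t₀ k (φ Q))
          at : ∀ n → T ℕ.≤ n → iterate Φ (Q , t) n ≡ (iterate φ Q₀ (n ℕ.∸ T) , t₀)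
          at n p = begin
            iterate Φ (Q , t) n                              ≡⟨ cong (iterate Φ (Q , t)) (ℕP.m+[n∸m]≡n p) ⟨
            iterate Φ (Q , t) (T ℕ.+ (n ℕ.∸ T))              ≡⟨ iterate-+ Φ (Q , t) T (n ℕ.∸ T) ⟩
            iterate Φ (iterate Φ (Q , t) T) (n ℕ.∸ T)        ≡⟨ cong (λ w → iterate Φ (Q₀ , w) (n ℕ.∸ T)) (second T Q t) ⟩
            iterate Φ (Q₀ , t₀) (n ℕ.∸ T)                    ≡⟨ from-t₀ (n ℕ.∸ T) Q₀ ⟩
            (iterate φ Q₀ (n ℕ.∸ T) , t₀)                    ∎

        -- Along multiples of `L` periodicity becomes constancy. This is the reason for using only
        -- places that are multiples of `L`.
        carry-constant : ∀ b Q t → ∃[ T ] (∀ g → T ℕ.≤ g →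
          iterate (carry step σ b) (Q , t) (L ℕ.* g) ≡ iterate (carry step σ b) (Q , t) (L ℕ.* T))
        carry-constant b Q t with carry-periodic b Q t
        ... | T , period = T , λ g p → subst (λ g → it (L ℕ.* g) ≡ it (L ℕ.* T)) (ℕP.m+[n∸m]≡n p) (go (g ℕ.∸ T))
          where
          open ≡-Reasoning
          it = iterate (carry step σ b) (Q , t)
          T≤ : ∀ j → T ℕ.≤ L ℕ.* (T ℕ.+ j)
          T≤ j = ℕP.≤-trans (ℕP.m≤m+n T j) (ℕP.m≤n*m (T ℕ.+ j) L {{ℕ.>-nonZero 1≤L}})
          go : ∀ j → it (L ℕ.* (T ℕ.+ j)) ≡ it (L ℕ.* T)
          go zero    = cong (λ k → it (L ℕ.* k)) (ℕP.+-identityʳ T)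
          go (suc j) = begin
            it (L ℕ.* (T ℕ.+ suc j))       ≡⟨ cong (λ k → it (L ℕ.* k)) (ℕP.+-suc T j) ⟩
            it (L ℕ.* suc (T ℕ.+ j))       ≡⟨ cong it (trans (ℕP.*-suc L (T ℕ.+ j)) (ℕP.+-comm L _)) ⟩
            it (L ℕ.* (T ℕ.+ j) ℕ.+ L)     ≡⟨ period _ (T≤ j) ⟩
            it (L ℕ.* (T ℕ.+ j))           ≡⟨ go j ⟩
            it (L ℕ.* T)                   ∎

        -- Once a long first gap has been read, `block-carry` leaves a settled state and carry with
        -- the rest of the sum added to the carry, which is a starting point of the same kind with
        -- one coefficient less. The result `R` includes the final quotient, from which signs can be
        -- read off.
        block-constant : ∀ as Q t → ∃[ T ] ∃[ R ] (∀ gs → List.map proj₁ gs ≡ as → All (λ ag → T ℕ.≤ proj₂ ag) gs →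
          iterate (block step σ) (Q , t ⊕ gapSum gs) (gapLength gs) ≡ R)
        block-constant []       Q t = 0 , (Q , t) , λ { [] _ _ → cong (Q ,_) (⊕-identityʳ t) }
        block-constant (a ∷ as) Q t with carry-constant (a ⊕ sumP as) Q t
        ... | T₁ , const₁ with block-constant as (proj₁ (iterate (carry step σ (a ⊕ sumP as)) (Q , t) (L ℕ.* T₁)))
                                                 (proj₂ (iterate (carry step σ (a ⊕ sumP as)) (Q , t) (L ℕ.* T₁)))
        ...   | T₂ , R , const₂ = T₁ ℕ.⊔ T₂ , R , λ
          { ((a , g) ∷ gs) refl (p ∷ ps) → begin
            iterate B (Q , t ⊕ gapSum ((a , g) ∷ gs)) (L ℕ.* g ℕ.+ gapLength gs)
              ≡⟨ iterate-+ B _ (L ℕ.* g) (gapLength gs) ⟩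
            iterate B (iterate B (Q , t ⊕ gapSum ((a , g) ∷ gs)) (L ℕ.* g)) (gapLength gs)
              ≡⟨ cong (λ w → iterate B w (gapLength gs)) (trans
                   (block-carry step σ (L ℕ.* g) Q t _ (gapSum gs))
                   (cong (Prod.map₂ (_⊕ gapSum gs)) (const₁ g (ℕP.m⊔n≤o⇒m≤o T₁ T₂ p)))) ⟩
            iterate B (Prod.map₂ (_⊕ gapSum gs) _) (gapLength gs)
              ≡⟨ const₂ gs refl (All.map (ℕP.m⊔n≤o⇒n≤o T₁ T₂) ps) ⟩
            R ∎ }
          where
          open ≡-Reasoning
          B = block step σ

-- Canonical representations

zeros : ∀ {m} → Vec ℕ m
zeros = Vec.replicate _ 0

value : ∀ {d m} → Letter d m → Point m
value = Vec.map proj₁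

val : ∀ {d m} → Word d m → Point m
val {d} = List.foldr (λ ℓ x → value ℓ ⊕ ((+ d) · x)) 𝟘

◃-sign : ∀ {m} (x : Point m) → Vec.zipWith _◃_ (Vec.map sign x) (Vec.map ∣_∣ x) ≡ x
◃-sign []       = refl
◃-sign (x ∷ xs) = cong₂ _∷_ (ℤP.signᵢ◃∣i∣≡i x) (◃-sign xs)

signed-value : ∀ {d} s {k} (p : k ℕ.< d) → proj₁ (signed s (k , p)) ≡ s ◃ k
signed-value Sign.+ {k}     p = sym (ℤP.+◃n≡+n k)
signed-value Sign.- {zero}  p = refl
signed-value Sign.- {suc k} p = refl

nthOr-drop : ∀ {A : Set} (z : A) xs j → nthOr z xs (suc j) ≡ nthOr z (List.drop 1 xs) j
nthOr-drop z []       j = refl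
nthOr-drop z (x ∷ xs) j = refl

maxLen-drop : ∀ {A : Set} {m} (rows : Vec (List A) m) → maxLen (Vec.map (List.drop 1) rows) ≡ ℕ.pred (maxLen rows)
maxLen-drop []             = refl
maxLen-drop (r ∷ rows) = trans (cong₂ ℕ._⊔_ (ListP.length-drop 1 r) (maxLen-drop rows))
  (sym (ℕP.mono-≤-distrib-⊔ ℕP.pred-mono-≤ (length r) (maxLen rows)))

module _ (d : ℕ) .{{_ : NonZero d}} where

  transpose : ∀ {m} → Vec (List (SDigit d)) m → Word d m
  transpose rows = List.map (λ j → Vec.map (λ r → nthOr (zeroD d) r j) rows) (upTo (maxLen rows))

  transpose-∷ : ∀ {m} (rows : Vec (List (SDigit d)) m) → maxLen rows ≢ 0 →
    transpose rows ≡ Vec.map (λ r → nthOr (zeroD d) r 0) rows ∷ transpose (Vec.map (List.drop 1) rows)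
  transpose-∷ rows nonempty = begin
    List.map column (upTo (maxLen rows))                ≡⟨ cong (List.map column ∘ upTo) (ℕP.suc-pred _ {{ℕ.≢-nonZero nonempty}}) ⟨
    List.map column (upTo (suc k))                      ≡⟨ cong (column 0 ∷_) (ListP.map-applyUpTo suc column k) ⟩
    column 0 ∷ applyUpTo (column ∘ suc) k               ≡⟨ cong (column 0 ∷_) (ListP.map-upTo (column ∘ suc) k) ⟨
    column 0 ∷ List.map (column ∘ suc) (upTo k)         ≡⟨ cong₂ (λ c n → column 0 ∷ List.map c (upTo n)) refl (maxLen-drop rows) ⟨
    column 0 ∷ List.map (column ∘ suc) (upTo (maxLen rows′)) ≡⟨ cong (column 0 ∷_) (ListP.map-cong next (upTo (maxLen rows′))) ⟩
    column 0 ∷ transpose rows′                          ∎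
    where
    open ≡-Reasoning
    k = ℕ.pred (maxLen rows)
    rows′ = Vec.map (List.drop 1) rows
    column = λ j → Vec.map (λ r → nthOr (zeroD d) r j) rows
    next : ∀ j → column (suc j) ≡ Vec.map (λ r → nthOr (zeroD d) r j) rows′
    next j = trans (VecP.map-cong (λ r → nthOr-drop (zeroD d) r j) rows) (VecP.map-∘ _ (List.drop 1) rows)

  module _ (2≤d : 2 ℕ.≤ d) where

    /-decreases : ∀ {n K} → n ℕ.≤ suc K → n ℕ./ d ℕ.≤ K
    /-decreases {zero}  {K} p = subst (ℕ._≤ K) (sym (ℕD.0/n≡0 d)) z≤n
    /-decreases {suc n} {K} p = ℕP.≤-pred (ℕP.≤-trans (ℕD.m/n<m (suc n) d 2≤d) p)

    digitsF-fuel : ∀ f g n → n ℕ.≤ f → n ℕ.≤ g → digitsF d f n ≡ digitsF d g n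
    digitsF-fuel zero    zero    zero    _ _ = refl
    digitsF-fuel zero    (suc g) zero    _ _ = refl
    digitsF-fuel (suc f) zero    zero    _ _ = refl
    digitsF-fuel (suc f) (suc g) zero    _ _ = refl
    digitsF-fuel (suc f) (suc g) (suc n) p q =
      cong (_ ∷_) (digitsF-fuel f g (suc n ℕ./ d) (/-decreases p) (/-decreases q))

    row : Sign → ℕ → List (SDigit d)
    row s n = List.map (signed s) (digitsℕ d n)

    drop-row : ∀ s n → List.drop 1 (row s n) ≡ row s (n ℕ./ d)
    drop-row s zero    = cong (row s) (sym (ℕD.0/n≡0 d))
    drop-row s (suc n) = cong (List.map (signed s)) (digitsF-fuel n _ _ (/-decreases ℕP.≤-refl) ℕP.≤-refl)

    head-row : ∀ s n → nthOr (zeroD d) (row s n) 0 ≡ digit d s (+ n)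
    head-row s zero    = trans (zero-digit s) (signed-cong s {p = ℕ.>-nonZero⁻¹ d} (sym (ℕD.m<n⇒m%n≡m (ℕ.>-nonZero⁻¹ d))))
      where
      zero-digit : ∀ s {p : 0 ℕ.< d} → zeroD d ≡ signed s (0 , p)
      zero-digit Sign.+ = cong (+ 0 ,_) (ℕP.<-irrelevant _ _)
      zero-digit Sign.- = cong (+ 0 ,_) (ℕP.<-irrelevant _ _)
    head-row s (suc n) = refl

    rows : ∀ {m} → Vec Sign m → Vec ℕ m → Vec (List (SDigit d)) m
    rows = Vec.zipWith row

    rows-canonℤ : ∀ {m} (σ : Vec Sign m) ns → Vec.map (canonℤ d) (Vec.zipWith _◃_ σ ns) ≡ rows σ ns
    rows-canonℤ []           []       = refl
    rows-canonℤ (s ∷ σ) (n ∷ ns) = cong₂ _∷_ (canonℤ-row s n) (rows-canonℤ σ ns)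
      where
      canonℤ-row : ∀ s n → canonℤ d (s ◃ n) ≡ row s n
      canonℤ-row Sign.+ zero    = refl
      canonℤ-row Sign.+ (suc n) = refl
      canonℤ-row Sign.- zero    = refl
      canonℤ-row Sign.- (suc n) = refl

    drop-rows : ∀ {m} (σ : Vec Sign m) ns → Vec.map (List.drop 1) (rows σ ns) ≡ rows σ (Vec.map (ℕ._/ d) ns)
    drop-rows []      []       = refl
    drop-rows (s ∷ σ) (n ∷ ns) = cong₂ _∷_ (drop-row s n) (drop-rows σ ns)

    head-rows : ∀ {m} (σ : Vec Sign m) ns →
      Vec.map (λ r → nthOr (zeroD d) r 0) (rows σ ns) ≡ letter d σ (Vec.map +_ ns)
    head-rows []      []       = refl
    head-rows (s ∷ σ) (n ∷ ns) = cong₂ _∷_ (head-row s n) (head-rows σ ns)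

    maxLen-zeros : ∀ {m} (σ : Vec Sign m) → maxLen (rows σ zeros) ≡ 0
    maxLen-zeros []      = refl
    maxLen-zeros (s ∷ σ) = maxLen-zeros σ

    maxLen-rows : ∀ {m} (σ : Vec Sign m) ns → maxLen (rows σ ns) ≡ 0 → ns ≡ zeros
    maxLen-rows []      []           p = refl
    maxLen-rows (s ∷ σ) (zero  ∷ ns) p = cong (0 ∷_) (maxLen-rows σ ns p)
    maxLen-rows (s ∷ σ) (suc n ∷ ns) p = contradiction
      (ℕP.n≤0⇒n≡0 (ℕP.≤-trans (ℕP.m≤m⊔n _ (maxLen (rows σ ns))) (ℕP.≤-reflexive p))) λ ()

    canon-zeros : ∀ {m} (σ : Vec Sign m) → canon d (Vec.zipWith _◃_ σ zeros) ≡ []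
    canon-zeros σ = trans (cong transpose (rows-canonℤ σ zeros))
      (cong (λ k → List.map (λ j → Vec.map (λ r → nthOr (zeroD d) r j) (rows σ zeros)) (upTo k)) (maxLen-zeros σ))

    canon-∷ : ∀ {m} (σ : Vec Sign m) ns → ns ≢ zeros → canon d (Vec.zipWith _◃_ σ ns)
      ≡ letter d σ (Vec.map +_ ns) ∷ canon d (Vec.zipWith _◃_ σ (Vec.map (ℕ._/ d) ns))
    canon-∷ σ ns ns≢0 = begin
      canon d (Vec.zipWith _◃_ σ ns)       ≡⟨ cong transpose (rows-canonℤ σ ns) ⟩
      transpose (rows σ ns)                ≡⟨ transpose-∷ (rows σ ns) (ns≢0 ∘ maxLen-rows σ ns) ⟩
      _                                    ≡⟨ cong₂ _∷_ (head-rows σ ns) (cong transpose (trans (drop-rows σ ns) (sym (rows-canonℤ σ (Vec.map (ℕ._/ d) ns))))) ⟩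
      letter d σ (Vec.map +_ ns) ∷ canon d (Vec.zipWith _◃_ σ (Vec.map (ℕ._/ d) ns)) ∎
      where open ≡-Reasoning

    Bounded : ∀ {m} → ℕ → Vec ℕ m → Set
    Bounded K = VAll.All (ℕ._≤ K)

    Bounded-/ : ∀ {m K} {ns : Vec ℕ m} → Bounded (suc K) ns → Bounded K (Vec.map (ℕ._/ d) ns)
    Bounded-/ []       = []
    Bounded-/ (p ∷ ps) = /-decreases p ∷ Bounded-/ ps

    Bounded-zero : ∀ {m} {ns : Vec ℕ m} → Bounded 0 ns → ns ≡ zeros
    Bounded-zero []        = refl
    Bounded-zero (z≤n ∷ p) = cong (0 ∷_) (Bounded-zero p)

    Bounded-sum : ∀ {m} (ns : Vec ℕ m) {K} → Vec.sum ns ℕ.≤ K → Bounded K ns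
    Bounded-sum []       p = []
    Bounded-sum (n ∷ ns) p = ℕP.m+n≤o⇒m≤o n p ∷ Bounded-sum ns (ℕP.m+n≤o⇒n≤o n p)

    value-letter : ∀ {m} (σ : Vec Sign m) ns →
      value (letter d σ (Vec.map +_ ns)) ≡ Vec.zipWith _◃_ σ (Vec.map (ℕ._% d) ns)
    value-letter []      []       = refl
    value-letter (s ∷ σ) (n ∷ ns) = cong₂ _∷_ (signed-value s (ℕD.m%n<n n d)) (value-letter σ ns)

    ◃-zeros : ∀ {m} (σ : Vec Sign m) → Vec.zipWith _◃_ σ zeros ≡ 𝟘
    ◃-zeros []           = refl
    ◃-zeros (Sign.+ ∷ σ) = cong (+ 0 ∷_) (◃-zeros σ)
    ◃-zeros (Sign.- ∷ σ) = cong (+ 0 ∷_) (◃-zeros σ)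

    ◃-zeros⁻¹ : ∀ {m} (σ : Vec Sign m) ns → Vec.zipWith _◃_ σ ns ≡ 𝟘 → ns ≡ zeros
    ◃-zeros⁻¹ []      []       p = refl
    ◃-zeros⁻¹ (s ∷ σ) (n ∷ ns) p = cong₂ _∷_
      (trans (sym (ℤP.abs-◃ s n)) (cong ∣_∣ (VecP.∷-injectiveˡ p)))
      (◃-zeros⁻¹ σ ns (VecP.∷-injectiveʳ p))

    divMod-◃ : ∀ {m} (σ : Vec Sign m) ns →
      Vec.zipWith _◃_ σ (Vec.map (ℕ._% d) ns) ⊕ ((+ d) · Vec.zipWith _◃_ σ (Vec.map (ℕ._/ d) ns)) ≡ Vec.zipWith _◃_ σ ns
    divMod-◃ []      []       = refl
    divMod-◃ (s ∷ σ) (n ∷ ns) = cong₂ _∷_ (begin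
      (s ◃ n ℕ.% d) + + d * (s ◃ n ℕ./ d)      ≡⟨ cong (_+_ (s ◃ n ℕ.% d)) (scale s (n ℕ./ d)) ⟩
      (s ◃ n ℕ.% d) + (s ◃ (n ℕ./ d) ℕ.* d)    ≡⟨ ℤP.◃-distrib-+ s (n ℕ.% d) (n ℕ./ d ℕ.* d) ⟨
      s ◃ (n ℕ.% d ℕ.+ n ℕ./ d ℕ.* d)          ≡⟨ cong (s ◃_) (ℕD.m≡m%n+[m/n]*n n d) ⟨
      s ◃ n                                    ∎) (divMod-◃ σ ns)
      where
      open ≡-Reasoning
      scale : ∀ s q → + d * (s ◃ q) ≡ s ◃ q ℕ.* d
      scale Sign.+ q = trans (cong (+ d *_) (ℤP.+◃n≡+n q)) (trans (sym (ℤP.pos-* d q))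
        (trans (cong +_ (ℕP.*-comm d q)) (sym (ℤP.+◃n≡+n _))))
      scale Sign.- q = begin
        + d * (Sign.- ◃ q)     ≡⟨ cong (+ d *_) (ℤP.-◃n≡-n q) ⟩
        + d * - + q            ≡⟨ ℤP.neg-distribʳ-* (+ d) (+ q) ⟨
        - (+ d * + q)          ≡⟨ cong -_ (ℤP.pos-* d q) ⟨
        - + (d ℕ.* q)          ≡⟨ cong (λ k → - + k) (ℕP.*-comm d q) ⟩
        - + (q ℕ.* d)          ≡⟨ ℤP.-◃n≡-n (q ℕ.* d) ⟨
        Sign.- ◃ q ℕ.* d       ∎

    zeros? : ∀ {m} (ns : Vec ℕ m) → Dec (ns ≡ zeros)
    zeros? ns = VecP.≡-dec ℕP._≟_ ns zeros

    val-canon-◃ : ∀ K {m} (σ : Vec Sign m) ns → Bounded K ns → val (canon d (Vec.zipWith _◃_ σ ns)) ≡ Vec.zipWith _◃_ σ ns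
    val-canon-◃ K σ ns b with zeros? ns
    val-canon-◃ K       σ ns b | yes refl = trans (cong val (canon-zeros σ)) (sym (◃-zeros σ))
    val-canon-◃ zero    σ ns b | no ns≢0  = contradiction (Bounded-zero b) ns≢0
    val-canon-◃ (suc K) σ ns b | no ns≢0  = begin
      val (canon d (Vec.zipWith _◃_ σ ns))   ≡⟨ cong val (canon-∷ σ ns ns≢0) ⟩
      value (letter d σ (Vec.map +_ ns)) ⊕ ((+ d) · val (canon d (Vec.zipWith _◃_ σ (Vec.map (ℕ._/ d) ns))))
        ≡⟨ cong₂ (λ x y → x ⊕ ((+ d) · y)) (value-letter σ ns) (val-canon-◃ K σ _ (Bounded-/ b)) ⟩
      _                                      ≡⟨ divMod-◃ σ ns ⟩
      Vec.zipWith _◃_ σ ns                   ∎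
      where open ≡-Reasoning

    -- A left inverse makes `canon` injective, so that acceptance of the word of a point amounts to
    -- membership of the point.
    val-canon : ∀ {m} (x : Point m) → val (canon d x) ≡ x
    val-canon x = subst (λ x → val (canon d x) ≡ x) (◃-sign x)
      (val-canon-◃ _ (Vec.map sign x) (Vec.map ∣_∣ x) (Bounded-sum _ ℕP.≤-refl))

    module _ {m : ℕ} {N : ℕ} (step : Fin N → Letter d m → Fin N) where

      -- The second component is the state reached at the last nonzero letter, so
      -- that it is insensitive to trailing zeros.
      track : Fin N × Fin N → Letter d m → Fin N × Fin N
      track (q , p) ℓ = step q ℓ , (if does (VecP.≡-dec ℤP._≟_ (value ℓ) 𝟘) then p else step q ℓ)

      module _ (σ : Vec Sign m) where

        track-zeros : ∀ K Q → proj₂ (run d track σ K Q (Vec.map +_ zeros)) ≡ proj₂ Q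
        track-zeros zero    Q       = refl
        track-zeros (suc K) (q , p) = trans
          (cong (λ z → proj₂ (run d track σ K (track (q , p) ℓ) z)) floor-zeros)
          (trans (track-zeros K (track (q , p) ℓ))
            (cong (if_then p else step q ℓ) (dec-true (VecP.≡-dec ℤP._≟_ (value ℓ) 𝟘) ℓ-zero)))
          where
          ℓ = letter d σ (Vec.map +_ zeros)
          floor-zeros : ∀ {m} → floor d {m} (Vec.map +_ zeros) ≡ Vec.map +_ zeros
          floor-zeros {zero}  = refl
          floor-zeros {suc m} = cong₂ _∷_ (cong +_ (ℕD.0/n≡0 d)) floor-zeros
          %-zeros : ∀ {m} → Vec.map (ℕ._% d) (zeros {m}) ≡ zeros
          %-zeros {zero}  = refl
          %-zeros {suc m} = cong₂ _∷_ (ℕD.m<n⇒m%n≡m (ℕ.>-nonZero⁻¹ d)) %-zeros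
          ℓ-zero : value ℓ ≡ 𝟘
          ℓ-zero = trans (value-letter σ zeros) (trans (cong (Vec.zipWith _◃_ σ) %-zeros) (◃-zeros σ))

        floor-+ : ∀ {m} (ns : Vec ℕ m) → floor d (Vec.map +_ ns) ≡ Vec.map +_ (Vec.map (ℕ._/ d) ns)
        floor-+ ns = trans (sym (VecP.map-∘ (_/ℕ d) +_ ns)) (VecP.map-∘ +_ (ℕ._/ d) ns)

        -- A nonempty canonical word ends in a nonzero letter, so running on past its end reads only
        -- zero letters, and the second component keeps the state in which the word ended.
        track-nonzero : ∀ K ns q p → Bounded K ns → ns ≢ zeros →
          proj₂ (run d track σ K (q , p) (Vec.map +_ ns)) ≡ foldl step q (canon d (Vec.zipWith _◃_ σ ns))
        track-nonzero zero    ns q p b ns≢0 = contradiction (Bounded-zero b) ns≢0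
        track-nonzero (suc K) ns q p b ns≢0 = begin
          proj₂ (run d track σ K (track (q , p) ℓ) (floor d (Vec.map +_ ns)))
            ≡⟨ cong (λ z → proj₂ (run d track σ K (track (q , p) ℓ) z)) (floor-+ ns) ⟩
          proj₂ (run d track σ K (track (q , p) ℓ) (Vec.map +_ ns′))
            ≡⟨ rest (zeros? ns′) ⟩
          foldl step (step q ℓ) (canon d (Vec.zipWith _◃_ σ ns′))
            ≡⟨ cong (foldl step q) (canon-∷ σ ns ns≢0) ⟨
          foldl step q (canon d (Vec.zipWith _◃_ σ ns)) ∎
          where
          open ≡-Reasoning
          ℓ = letter d σ (Vec.map +_ ns)
          ns′ = Vec.map (ℕ._/ d) ns
          /%-zeros : ∀ {m} (ns : Vec ℕ m) → Vec.map (ℕ._/ d) ns ≡ zeros → Vec.map (ℕ._% d) ns ≡ zeros → ns ≡ zeros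
          /%-zeros []       _ _ = refl
          /%-zeros (n ∷ ns) p q = cong₂ _∷_
            (trans (ℕD.m≡m%n+[m/n]*n n d) (cong₂ (λ r q → r ℕ.+ q ℕ.* d) (VecP.∷-injectiveˡ q) (VecP.∷-injectiveˡ p)))
            (/%-zeros ns (VecP.∷-injectiveʳ p) (VecP.∷-injectiveʳ q))
          rest : Dec (ns′ ≡ zeros) → proj₂ (run d track σ K (track (q , p) ℓ) (Vec.map +_ ns′))
               ≡ foldl step (step q ℓ) (canon d (Vec.zipWith _◃_ σ ns′))
          rest (no ns′≢0) = track-nonzero K ns′ _ _ (Bounded-/ b) ns′≢0
          -- This letter is the last one. It is nonzero, since otherwise both quotients and
          -- remainders of `ns` would vanish.
          rest (yes ns′≡0) = begin
            proj₂ (run d track σ K (track (q , p) ℓ) (Vec.map +_ ns′))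
              ≡⟨ cong (λ z → proj₂ (run d track σ K (track (q , p) ℓ) (Vec.map +_ z))) ns′≡0 ⟩
            proj₂ (run d track σ K (track (q , p) ℓ) (Vec.map +_ zeros))
              ≡⟨ track-zeros K _ ⟩
            proj₂ (track (q , p) ℓ)
              ≡⟨ cong (if_then p else step q ℓ) (dec-false (VecP.≡-dec ℤP._≟_ (value ℓ) 𝟘) (λ ℓ≡0 →
                   ns≢0 (/%-zeros ns ns′≡0 (◃-zeros⁻¹ σ _ (trans (sym (value-letter σ ns)) ℓ≡0))))) ⟩
            step q ℓ
              ≡⟨ cong (foldl step (step q ℓ)) (trans (cong (canon d ∘ Vec.zipWith _◃_ σ) ns′≡0) (canon-zeros σ)) ⟨
            foldl step (step q ℓ) (canon d (Vec.zipWith _◃_ σ ns′)) ∎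

        -- With equal components at the start, the zero point is no exception: its word is empty and
        -- the second component is never updated.
        track-canon : ∀ K ns q → Bounded K ns →
          proj₂ (run d track σ K (q , q) (Vec.map +_ ns)) ≡ foldl step q (canon d (Vec.zipWith _◃_ σ ns))
        track-canon K ns q b with zeros? ns
        ... | no ns≢0 = track-nonzero K ns q q b ns≢0
        ... | yes refl = trans (track-zeros K (q , q)) (cong (foldl step q) (sym (canon-zeros σ)))

-- Acceptance at far apart places in a fixed order

∣-! : ∀ {k n} → 1 ℕ.≤ k → k ℕ.≤ n → k ∣ n !
∣-! {suc k} _ k≤n = ∣-trans (m∣m*n (k !)) (m≤n⇒m!∣n! k≤n)

-- Among the iterates number 0 to N² two coincide. The cycle length is at most N² and so divides
-- (N²)!, which makes the period uniform in `φ` and `Q`.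
iterate-periodic : ∀ N (φ : Fin N × Fin N → Fin N × Fin N) Q n → N ℕ.* N ℕ.≤ n →
  iterate φ Q (n ℕ.+ (N ℕ.* N) !) ≡ iterate φ Q n
iterate-periodic N φ Q n N²≤n with FinP.pigeonhole (ℕP.n<1+n (N ℕ.* N)) (λ i → let q , p = iterate φ Q (toℕ i) in Fin.combine q p)
... | i , j , i<j , eq = begin
  iterate φ Q (n ℕ.+ L)                          ≡⟨ cong (λ k → iterate φ Q (k ℕ.+ L)) (ℕP.m+[n∸m]≡n i≤n) ⟨
  iterate φ Q (toℕ i ℕ.+ c ℕ.+ L)                ≡⟨ cong (iterate φ Q) (trans (ℕP.+-assoc (toℕ i) c L) (cong (toℕ i ℕ.+_) (ℕP.+-comm c L))) ⟩
  iterate φ Q (toℕ i ℕ.+ (L ℕ.+ c))              ≡⟨ iterate-+ φ Q (toℕ i) (L ℕ.+ c) ⟩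
  iterate φ x (L ℕ.+ c)                          ≡⟨ iterate-+ φ x L c ⟩
  iterate φ (iterate φ x L) c                    ≡⟨ cong (λ y → iterate φ y c) (multiple (∣-! (ℕP.m<n⇒0<n∸m i<j) p≤N²)) ⟩
  iterate φ x c                                  ≡⟨ iterate-+ φ Q (toℕ i) c ⟨
  iterate φ Q (toℕ i ℕ.+ c)                      ≡⟨ cong (iterate φ Q) (ℕP.m+[n∸m]≡n i≤n) ⟩
  iterate φ Q n                                  ∎
  where
  open ≡-Reasoning
  L = (N ℕ.* N) !
  j≤N² = FinP.toℕ≤pred[n] j
  i≤n = ℕP.≤-trans (ℕP.<⇒≤ i<j) (ℕP.≤-trans j≤N² N²≤n)
  c = n ℕ.∸ toℕ i
  p = toℕ j ℕ.∸ toℕ i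
  p≤N² = ℕP.≤-trans (ℕP.m∸n≤m (toℕ j) (toℕ i)) j≤N²
  x = iterate φ Q (toℕ i)
  same : iterate φ Q (toℕ i) ≡ iterate φ Q (toℕ j)
  same = cong₂ _,_ (FinP.combine-injectiveˡ (proj₁ x) (proj₂ x) _ _ eq) (FinP.combine-injectiveʳ (proj₁ x) (proj₂ x) _ _ eq)
  returns : iterate φ x p ≡ x
  returns = trans (sym (iterate-+ φ Q (toℕ i) p)) (trans (cong (iterate φ Q) (ℕP.m+[n∸m]≡n (ℕP.<⇒≤ i<j))) (sym same))
  multiples : ∀ k → iterate φ x (k ℕ.* p) ≡ x
  multiples zero    = refl
  multiples (suc k) = trans (iterate-+ φ x p (k ℕ.* p)) (trans (cong (λ y → iterate φ y (k ℕ.* p)) returns) (multiples k))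
  multiple : p ∣ L → iterate φ x L ≡ x
  multiple (divides k L≡) = trans (cong (iterate φ x) L≡) (multiples k)

flip : Sign → ℤ → ℤ
flip Sign.+ z = z
flip Sign.- z = - z

flip-+ : ∀ s x y → flip s (x + y) ≡ flip s x + flip s y
flip-+ Sign.+ x y = refl
flip-+ Sign.- x y = ℤP.neg-distrib-+ x y

flip-* : ∀ s c x → flip s (c * x) ≡ c * flip s x
flip-* Sign.+ c x = refl
flip-* Sign.- c x = ℤP.neg-distribʳ-* c x

flip-0 : ∀ s → flip s (+ 0) ≡ + 0
flip-0 Sign.+ = refl
flip-0 Sign.- = refl

flips : ∀ {m} → Vec Sign m → Point m → Point m
flips = Vec.zipWith flip

flips-⊕ : ∀ {m} (σ : Vec Sign m) x y → flips σ (x ⊕ y) ≡ flips σ x ⊕ flips σ y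
flips-⊕ []      []       []       = refl
flips-⊕ (s ∷ σ) (x ∷ xs) (y ∷ ys) = cong₂ _∷_ (flip-+ s x y) (flips-⊕ σ xs ys)

flips-· : ∀ {m} (σ : Vec Sign m) c x → flips σ (c · x) ≡ c · flips σ x
flips-· []      c []       = refl
flips-· (s ∷ σ) c (x ∷ xs) = cong₂ _∷_ (flip-* s c x) (flips-· σ c xs)

flips-𝟘 : ∀ {m} (σ : Vec Sign m) → flips σ 𝟘 ≡ 𝟘
flips-𝟘 []      = refl
flips-𝟘 (s ∷ σ) = cong₂ _∷_ (flip-0 s) (flips-𝟘 σ)

flips-sumP : ∀ {m} (σ : Vec Sign m) as → flips σ (sumP as) ≡ sumP (List.map (flips σ) as)
flips-sumP σ []       = flips-𝟘 σ
flips-sumP σ (a ∷ as) = trans (flips-⊕ σ a (sumP as)) (cong (flips σ a ⊕_) (flips-sumP σ as))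

module _ (d : ℕ) .{{_ : NonZero d}} (2≤d : 2 ℕ.≤ d) where

  open import Data.Integer using (_≤_; _<_)

  -- Floors of negative numbers never climb to 0; they end at -1. The sign of a number can thus be
  -- recovered from a quotient left after any number of divisions.
  sign-floors : ∀ k x → sign (floors d k x) ≡ sign x
  sign-floors k (+ n) with floors d k (+ n) in eq
  ... | + _      = refl
  ... | -[1+ _ ] = contradiction
    (subst (+ 0 ≤_) eq (ℤP.≤-trans (floors-≥ d 2≤d k 0) (floors-mono d k (ℤ.+≤+ z≤n)))) λ ()
  sign-floors k -[1+ n ] with floors d k -[1+ n ] in eq
  ... | + _      = contradiction (subst (_< + 0) eq (floors-neg d k ℤ.-<+)) λ { (ℤ.+<+ ()) }
  ... | -[1+ _ ] = refl

  sign-floorⁿ : ∀ {m} k (x : Point m) → Vec.map sign (floorⁿ d k x) ≡ Vec.map sign x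
  sign-floorⁿ k []       = cong (Vec.map sign) (Point₀-unique (floorⁿ d k []) [])
  sign-floorⁿ k (x ∷ xs) = trans (cong (Vec.map sign) (floorⁿ-∷ d k x xs)) (cong₂ _∷_ (sign-floors k x) (sign-floorⁿ k xs))

  flips-sign : ∀ {m} (x : Point m) → flips (Vec.map sign x) x ≡ Vec.map +_ (Vec.map ∣_∣ x)
  flips-sign []              = refl
  flips-sign (+ n ∷ xs)      = cong (+ n ∷_) (flips-sign xs)
  flips-sign (-[1+ n ] ∷ xs) = cong (+ suc n ∷_) (flips-sign xs)

  module _ (δ′ L : ℕ) {m : ℕ} where

    flipList : Vec Sign m → List (Point m × ℕ) → List (Point m × ℕ)
    flipList σ = List.map (Prod.map₁ (flips σ))

    flipList-coefficients : ∀ σ gs → List.map proj₁ (flipList σ gs) ≡ List.map (flips σ) (List.map proj₁ gs)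
    flipList-coefficients σ gs = trans (sym (ListP.map-∘ gs)) (ListP.map-∘ gs)

    flips-gapSum : ∀ σ gs → flips σ (gapSum d δ′ L gs) ≡ gapSum d δ′ L (flipList σ gs)
    flips-gapSum σ []             = flips-𝟘 σ
    flips-gapSum σ ((a , g) ∷ gs) = trans (flips-⊕ σ _ _) (cong₂ _⊕_
      (trans (flips-· σ r _) (cong (r ·_) (trans (flips-⊕ σ a _) (cong (flips σ a ⊕_)
        (trans (flips-sumP σ (List.map proj₁ gs)) (cong sumP (sym (flipList-coefficients σ gs))))))))
      (trans (flips-· σ p _) (cong (p ·_) (flips-gapSum σ gs))))
      where
      r = repunit d δ′ (L ℕ.* g)
      p = (+ (d ℕ.^ suc δ′)) ℤ.^ (L ℕ.* g)

    gapLength-flipList : ∀ σ gs → gapLength d δ′ L (flipList σ gs) ≡ gapLength d δ′ L gs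
    gapLength-flipList σ []             = refl
    gapLength-flipList σ ((a , g) ∷ gs) = cong (L ℕ.* g ℕ.+_) (gapLength-flipList σ gs)

  module _ {m : ℕ} (M : DFA d m) where
    open DFA M

    accepts : Point m → Bool
    accepts x = accept (foldl step start (canon d x))

    module _ (δ′ : ℕ) where

      private
        N = nStates
        L = (N ℕ.* N) !
        δ = suc δ′
        1≤L : 1 ℕ.≤ L
        1≤L = ℕ.>-nonZero⁻¹ L {{(N ℕ.* N) ℕP.!≢0}}
        Step = track d 2≤d step

      -- The letters of the canonical word depend on the signs of the whole point, which are visible
      -- only at its top end. The first use of `block-constant`, with arbitrary signs, serves to
      -- find the quotient `t*` that all these points leave, and with it their common sign vector;
      -- the second follows the automaton on the absolute values.
      accepts-constant : ∀ as t → ∃[ T ] ∃[ v ] (∀ gs → List.map proj₁ gs ≡ as → All (λ ag → T ℕ.≤ proj₂ ag) gs →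
        accepts (t ⊕ gapSum d δ′ L gs) ≡ v)
      accepts-constant as t with block-constant d δ′ L 2≤d 1≤L Step (N ℕ.* N) (iterate-periodic N) (Vec.replicate m Sign.+) as (start , start) t
      ... | T₁ , (_ , t*) , const₁ with block-constant d δ′ L 2≤d 1≤L Step (N ℕ.* N) (iterate-periodic N) (Vec.map sign t*)
                (List.map (flips (Vec.map sign t*)) as) (start , start) (flips (Vec.map sign t*) t)
      -- The value is sampled at `gs₀`. Another point is compared with it by running both equally
      -- far beyond the last place; the sum of the two sizes lies beyond the end of either word.
      ...   | T₂ , (Q₂ , t₂) , const₂ = T₁ ℕ.⊔ T₂ , accepts (x gs₀) , λ gs ≡as ps → let
            K = Vec.sum (Vec.map ∣_∣ (x gs)) ; K₀ = Vec.sum (Vec.map ∣_∣ (x gs₀)) in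
            trans (constant gs ≡as ps (K ℕ.+ K₀) (ℕP.m≤m+n K K₀))
              (sym (constant gs₀ ≡as₀ gs₀-wide (K ℕ.+ K₀) (ℕP.m≤n+m K₀ K)))
        where
        -- floor division preserves signs, so σ is the sign vector of every x gs
        σ = Vec.map sign t*
        x = λ gs → t ⊕ gapSum d δ′ L gs
        gs₀ = List.map (_, T₁ ℕ.⊔ T₂) as
        ≡as₀ : List.map proj₁ gs₀ ≡ as
        ≡as₀ = trans (sym (ListP.map-∘ as)) (ListP.map-id as)
        gs₀-wide : All (λ ag → T₁ ℕ.⊔ T₂ ℕ.≤ proj₂ ag) gs₀
        gs₀-wide = AllP.map⁺ (All.universal (λ _ → ℕP.≤-refl) as)
        constant : ∀ gs → List.map proj₁ gs ≡ as → All (λ ag → T₁ ℕ.⊔ T₂ ℕ.≤ proj₂ ag) gs →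
          ∀ K₀ → Vec.sum (Vec.map ∣_∣ (x gs)) ℕ.≤ K₀ → accepts (x gs) ≡ accept (proj₂ (run d Step σ K₀ Q₂ t₂))
        constant gs ≡as ps K₀ ≤K₀ = cong accept (begin
          foldl step start (canon d (x gs))
            ≡⟨ cong (foldl step start ∘ canon d) (◃-sign (x gs)) ⟨
          foldl step start (canon d (Vec.zipWith _◃_ (Vec.map sign (x gs)) ns))
            ≡⟨ cong (λ σ → foldl step start (canon d (Vec.zipWith _◃_ σ ns))) σ≡ ⟨
          foldl step start (canon d (Vec.zipWith _◃_ σ ns))
            ≡⟨ track-canon d 2≤d step σ (K ℕ.+ K₀) ns start (Bounded-sum d 2≤d ns (ℕP.≤-trans ≤K₀ (ℕP.m≤n+m K₀ K))) ⟨
          proj₂ (run d Step σ (K ℕ.+ K₀) (start , start) (Vec.map +_ ns))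
            ≡⟨ cong (proj₂ ∘ run d Step σ (K ℕ.+ K₀) (start , start)) (flips-sign (x gs)) ⟨
          proj₂ (run d Step σ (K ℕ.+ K₀) (start , start) (flips (Vec.map sign (x gs)) (x gs)))
            ≡⟨ cong (λ σ′ → proj₂ (run d Step σ (K ℕ.+ K₀) (start , start) (flips σ′ (x gs)))) σ≡ ⟨
          proj₂ (run d Step σ (K ℕ.+ K₀) (start , start) (flips σ (x gs)))
            ≡⟨ cong proj₂ (run-+ d Step σ K K₀ _ _) ⟩
          proj₂ (run d Step σ K₀ (run d Step σ K (start , start) (flips σ (x gs))) (floorⁿ d K (flips σ (x gs))))
            ≡⟨ cong (λ Qt → proj₂ (run d Step σ K₀ (proj₁ Qt) (proj₂ Qt))) flipped ⟩
          proj₂ (run d Step σ K₀ Q₂ t₂) ∎)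
          where
          open ≡-Reasoning
          ns = Vec.map ∣_∣ (x gs)
          K = gapLength d δ′ L gs ℕ.* δ
          σ≡ : σ ≡ Vec.map sign (x gs)
          σ≡ = trans (cong (Vec.map sign) (sym (trans
                 (cong proj₂ (sym (block-iterate d δ′ Step (Vec.replicate m Sign.+) (gapLength d δ′ L gs) (start , start) (x gs))))
                 (cong proj₂ (const₁ gs ≡as (All.map (ℕP.m⊔n≤o⇒m≤o T₁ T₂) ps))))))
               (sign-floorⁿ K (x gs))
          flipped : (run d Step σ K (start , start) (flips σ (x gs)) , floorⁿ d K (flips σ (x gs))) ≡ (Q₂ , t₂)
          flipped = begin
            (run d Step σ K (start , start) (flips σ (x gs)) , floorⁿ d K (flips σ (x gs)))
              ≡⟨ block-iterate d δ′ Step σ (gapLength d δ′ L gs) (start , start) (flips σ (x gs)) ⟨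
            iterate (block d δ′ Step σ) ((start , start) , flips σ (x gs)) (gapLength d δ′ L gs)
              ≡⟨ cong₂ (λ y n → iterate (block d δ′ Step σ) ((start , start) , y) n)
                   (trans (flips-⊕ σ t _) (cong (flips σ t ⊕_) (flips-gapSum δ′ L σ gs)))
                   (sym (gapLength-flipList δ′ L σ gs)) ⟩
            iterate (block d δ′ Step σ) ((start , start) , flips σ t ⊕ gapSum d δ′ L (flipList δ′ L σ gs)) (gapLength d δ′ L (flipList δ′ L σ gs))
              ≡⟨ const₂ (flipList δ′ L σ gs) (trans (flipList-coefficients δ′ L σ gs) (cong (List.map (flips σ)) ≡as))
                   (AllP.map⁺ (All.map (ℕP.m⊔n≤o⇒n≤o T₁ T₂) ps)) ⟩
            (Q₂ , t₂) ∎

-- Placements of coefficients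

⊕-assoc : ∀ {m} (x y z : Point m) → (x ⊕ y) ⊕ z ≡ x ⊕ (y ⊕ z)
⊕-assoc = VecP.zipWith-assoc ℤP.+-assoc

⊕-comm : ∀ {m} (x y : Point m) → x ⊕ y ≡ y ⊕ x
⊕-comm = VecP.zipWith-comm ℤP.+-comm

⊕-identityˡ : ∀ {m} (x : Point m) → 𝟘 ⊕ x ≡ x
⊕-identityˡ = VecP.zipWith-identityˡ ℤP.+-identityˡ

⊕-swap : ∀ {m} (x y z : Point m) → x ⊕ (y ⊕ z) ≡ y ⊕ (x ⊕ z)
⊕-swap x y z = trans (sym (⊕-assoc x y z)) (trans (cong (_⊕ z) (⊕-comm x y)) (⊕-assoc y x z))

module _ {A : Set} where

  inserts : A → List A → List (List A)
  inserts x []       = (x ∷ []) ∷ []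
  inserts x (y ∷ ys) = (x ∷ y ∷ ys) ∷ List.map (y ∷_) (inserts x ys)

  permutations : List A → List (List A)
  permutations []       = [] ∷ []
  permutations (x ∷ xs) = concatMap (inserts x) (permutations xs)

  picks : List A → List (A × List A)
  picks []       = []
  picks (x ∷ xs) = (x , xs) ∷ List.map (Prod.map₂ (x ∷_)) (picks xs)

  picks-↭ : ∀ xs {y ys} → (y , ys) ∈ picks xs → xs ↭ y ∷ ys
  picks-↭ (x ∷ xs) (here refl) = ↭-refl
  picks-↭ (x ∷ xs) (there i) with ∈P.∈-map⁻ (Prod.map₂ (x ∷_)) i
  ... | (y , ys) , j , refl = ↭-trans (prep x (picks-↭ xs j)) (swap x y ↭-refl)

  ∈-picks : ∀ {xs y} → y ∈ xs → ∃[ ys ] (y , ys) ∈ picks xs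
  ∈-picks (here refl) = _ , here refl
  ∈-picks (there i)   = let ys , j = ∈-picks i in _ , there (∈P.∈-map⁺ _ j)

picks-map : ∀ {A B : Set} (f : A → B) xs {y ys} → (y , ys) ∈ picks xs → (f y , List.map f ys) ∈ picks (List.map f xs)
picks-map f (x ∷ xs) (here refl) = here refl
picks-map f (x ∷ xs) (there i) with ∈P.∈-map⁻ (Prod.map₂ (x ∷_)) i
... | (y , ys) , j , refl = there (∈P.∈-map⁺ (Prod.map₂ (f x ∷_)) (picks-map f xs j))

module _ {A : Set} where

  Placement : Set
  Placement = List (A × ℕ)

  coefficients : Placement → List A
  coefficients = List.map proj₁

  data Increasing (T : ℕ) : ℕ → Placement → Set where
    []  : ∀ {b} → Increasing T b []
    _∷_ : ∀ {b a p ps} → b ℕ.+ T ℕ.≤ p → Increasing T p ps → Increasing T b ((a , p) ∷ ps)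

  Increasing-weaken : ∀ {T T′ b ps} → T′ ℕ.≤ T → Increasing T b ps → Increasing T′ b ps
  Increasing-weaken         T′≤T []       = []
  Increasing-weaken {b = b} T′≤T (p ∷ ps) = ℕP.≤-trans (ℕP.+-monoʳ-≤ b T′≤T) p ∷ Increasing-weaken T′≤T ps

  Increasing-lower : ∀ {T b b′ ps} → b′ ℕ.≤ b → Increasing T b ps → Increasing T b′ ps
  Increasing-lower     b′≤b []       = []
  Increasing-lower {T} b′≤b (p ∷ ps) = ℕP.≤-trans (ℕP.+-monoˡ-≤ T b′≤b) p ∷ ps

  spread : ℕ → ℕ → List A → Placement
  spread T b []       = []
  spread T b (a ∷ as) = (a , b ℕ.+ T) ∷ spread T (b ℕ.+ T) as

  spread-end : ℕ → ℕ → List A → ℕ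
  spread-end T b []       = b
  spread-end T b (a ∷ as) = spread-end T (b ℕ.+ T) as

  spread-increasing : ∀ T b as {ps} → Increasing T (spread-end T b as) ps → Increasing T b (spread T b as ++ ps)
  spread-increasing T b []       i = i
  spread-increasing T b (a ∷ as) i = ℕP.≤-refl ∷ spread-increasing T (b ℕ.+ T) as i

  coefficients-spread : ∀ T b as → coefficients (spread T b as) ≡ as
  coefficients-spread T b []       = refl
  coefficients-spread T b (a ∷ as) = cong (a ∷_) (coefficients-spread T (b ℕ.+ T) as)

  Near : ℕ → ℕ → ℕ → Set
  Near T p q = p ℕ.≤ q × q ℕ.< p ℕ.+ T

  -- A positive form of the failure of all `Increasing T 0` arrangements: it names the parameter to
  -- be fixed or the pair to be fused.
  data Crowded (T : ℕ) (ps : Placement) : Set where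
    low   : ∀ {a p rest} → ((a , p) , rest) ∈ picks ps → p ℕ.< T → Crowded T ps
    close : ∀ {a p rest b q rest′} → ((a , p) , rest) ∈ picks ps → ((b , q) , rest′) ∈ picks rest →
            Near T p q → Crowded T ps

  -- Insertion gets stuck only at an entry within distance `T` of `p`. The bound `β` is the entry
  -- passed last, so the gap below the inserted place is known.
  place : ∀ T β a p ps → Increasing T β ps → β ℕ.+ T ℕ.≤ p →
    (∃[ qs ] (qs ↭ (a , p) ∷ ps × Increasing T β qs × coefficients qs ∈ inserts a (coefficients ps)))
    ⊎ (∃[ y ] (y ∈ ps × (Near T p (proj₂ y) ⊎ Near T (proj₂ y) p)))
  place T β a p []             _         β≤p = inj₁ (_ , ↭-refl , β≤p ∷ [] , here refl)
  place T β a p ((b , q) ∷ ps) (β≤q ∷ i) β≤p with p ℕ.+ T ℕP.≤? q | q ℕ.+ T ℕP.≤? p | ℕP.≤-total p q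
  ... | yes p≤q | _       | _        = inj₁ (_ , ↭-refl , β≤p ∷ p≤q ∷ i , here refl)
  ... | no p≰q  | no _    | inj₁ p≤q = inj₂ (_ , here refl , inj₁ (p≤q , ℕP.≰⇒> p≰q))
  ... | no _    | no q≰p  | inj₂ q≤p = inj₂ (_ , here refl , inj₂ (q≤p , ℕP.≰⇒> q≰p))
  ... | no _    | yes q≤p | _        with place T q a p ps i q≤p
  ...   | inj₁ (qs , perm , j , ∈ins) = inj₁ (_ , ↭-trans (prep _ perm) (swap _ _ ↭-refl) , β≤q ∷ j , there (∈P.∈-map⁺ _ ∈ins))
  ...   | inj₂ (y , y∈ps , near)      = inj₂ (y , there y∈ps , near)

  -- Membership in `permutations` confines the resulting order to a finite list known before the
  -- places are, so that one threshold can be chosen for all orders.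
  sort-or-crowded : ∀ T ps →
    (∃[ qs ] (qs ↭ ps × Increasing T 0 qs × coefficients qs ∈ permutations (coefficients ps))) ⊎ Crowded T ps
  sort-or-crowded T []             = inj₁ ([] , ↭-refl , [] , here refl)
  sort-or-crowded T ((a , p) ∷ ps) with T ℕP.≤? p | sort-or-crowded T ps
  ... | no T≰p  | _                   = inj₂ (low (here refl) (ℕP.≰⇒> T≰p))
  ... | yes _   | inj₂ (low i q<T)    = inj₂ (low (there (∈P.∈-map⁺ _ i)) q<T)
  ... | yes _   | inj₂ (close i j near) = inj₂ (close (there (∈P.∈-map⁺ _ i)) (there (∈P.∈-map⁺ _ j)) near)
  ... | yes T≤p | inj₁ (qs , perm , inc , ∈perms) with place T 0 a p qs inc T≤p
  ...   | inj₁ (rs , perm′ , inc′ , ∈ins) = inj₁ (rs , ↭-trans perm′ (prep _ perm) , inc′ ,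
            ∈P.∈-concatMap⁺ (inserts a) (Any.map (λ { refl → ∈ins }) ∈perms))
  ...   | inj₂ (y , y∈qs , near) with ∈-picks (↭P.∈-resp-↭ perm y∈qs)
  ...     | ys , i with near
  ...       | inj₁ near₁ = inj₂ (close (here refl) i near₁)
  ...       | inj₂ near₂ = inj₂ (close (there (∈P.∈-map⁺ _ i)) (here refl) near₂)

module _ (d : ℕ) .{{_ : NonZero d}} (δ′ L : ℕ) where

  private
    D : ℤ
    D = + (d ℕ.^ suc δ′)

  rep : ℕ → ℤ
  rep n = repunit d δ′ (L ℕ.* n)

  pow : ℕ → ℤ
  pow n = D ℤ.^ (L ℕ.* n)

  rep-+ : ∀ j k → rep (j ℕ.+ k) ≡ rep j + pow j * rep k
  rep-+ j k = trans (cong (repunit d δ′) (ℕP.*-distribˡ-+ L j k)) (repunit-+ d δ′ (L ℕ.* j) (L ℕ.* k))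

  pow-+ : ∀ j k → pow (j ℕ.+ k) ≡ pow j * pow k
  pow-+ j k = trans (cong (D ℤ.^_) (ℕP.*-distribˡ-+ L j k)) (ℤP.^-distribˡ-+-* D (L ℕ.* j) (L ℕ.* k))

  module _ {m : ℕ} where

    place-sum : List (Point m × ℕ) → Point m
    place-sum = List.foldr (λ ap x → (rep (proj₂ ap) · proj₁ ap) ⊕ x) 𝟘

    place-sum-++ : ∀ ps qs → place-sum (ps ++ qs) ≡ place-sum ps ⊕ place-sum qs
    place-sum-++ []       qs = sym (⊕-identityˡ _)
    place-sum-++ (p ∷ ps) qs = trans (cong (_ ⊕_) (place-sum-++ ps qs)) (sym (⊕-assoc _ (place-sum ps) (place-sum qs)))

    place-sum-↭ : ∀ {ps qs} → ps ↭ qs → place-sum ps ≡ place-sum qs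
    place-sum-↭ ↭.refl        = refl
    place-sum-↭ (prep x p)   = cong (_ ⊕_) (place-sum-↭ p)
    place-sum-↭ (swap x y p) = trans (⊕-swap _ _ _) (cong (λ s → _ ⊕ (_ ⊕ s)) (place-sum-↭ p))
    place-sum-↭ (↭.trans p q)  = trans (place-sum-↭ p) (place-sum-↭ q)

    gaps : ℕ → List (Point m × ℕ) → List (Point m × ℕ)
    gaps b []             = []
    gaps b ((a , p) ∷ ps) = (a , p ℕ.∸ b) ∷ gaps p ps

    coefficients-gaps : ∀ b ps → coefficients (gaps b ps) ≡ coefficients ps
    coefficients-gaps b []             = refl
    coefficients-gaps b ((a , p) ∷ ps) = cong (a ∷_) (coefficients-gaps p ps)

    gaps-wide : ∀ {T b ps} → Increasing T b ps → All (λ ag → T ℕ.≤ proj₂ ag) (gaps b ps)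
    gaps-wide         []      = []
    gaps-wide {T} {b} (p ∷ i) = ℕP.m+n≤o⇒m≤o∸n T (ℕP.≤-trans (ℕP.≤-reflexive (ℕP.+-comm T b)) p) ∷ gaps-wide i

    -- By R(b + g) = R(b) + P(b) R(g) each term splits into a part below place `b`, which depends on
    -- the coefficient alone, and a term counted from `b` onwards. The base `b` is general for the
    -- induction; the case 0 is the one wanted.
    place-sum-gaps : ∀ {T b ps} → Increasing T b ps →
      place-sum ps ≡ (rep b · sumP (coefficients ps)) ⊕ (pow b · gapSum d δ′ L (gaps b ps))
    place-sum-gaps {b = b} [] = e (rep b) (pow b)
      where
      e : ∀ {m} r p → 𝟘 {m} ≡ (r · 𝟘) ⊕ (p · 𝟘)
      e {zero}  r p = refl
      e {suc m} r p = cong₂ _∷_ (sym (cong₂ _+_ (ℤP.*-zeroʳ r) (ℤP.*-zeroʳ p))) (e r p)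
    place-sum-gaps {b = b} (_∷_ {a = a} {p = q} {ps = ps} p i) = begin
      (rep q · a) ⊕ place-sum ps
        ≡⟨ cong ((rep q · a) ⊕_) (place-sum-gaps i) ⟩
      (rep q · a) ⊕ ((rep q · s) ⊕ (pow q · y))
        ≡⟨ cong₂ (λ r p → (r · a) ⊕ ((r · s) ⊕ (p · y)))
             (trans (cong rep b+g) (rep-+ b g)) (trans (cong pow b+g) (pow-+ b g)) ⟩
      ((rep b + pow b * rep g) · a) ⊕ (((rep b + pow b * rep g) · s) ⊕ ((pow b * pow g) · y))
        ≡⟨ e (rep b) (pow b) (rep g) (pow g) a s y ⟩
      (rep b · (a ⊕ s)) ⊕ (pow b · ((rep g · (a ⊕ s)) ⊕ (pow g · y)))
        ≡⟨ cong (λ s → (rep b · (a ⊕ sumP (coefficients ps))) ⊕ (pow b · ((rep g · (a ⊕ s)) ⊕ (pow g · y)))) (cong sumP (sym (coefficients-gaps q ps))) ⟩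
      (rep b · (a ⊕ s)) ⊕ (pow b · gapSum d δ′ L ((a , g) ∷ gaps q ps)) ∎
      where
      open ≡-Reasoning
      g = q ℕ.∸ b
      b+g : q ≡ b ℕ.+ g
      b+g = sym (ℕP.m+[n∸m]≡n (ℕP.m+n≤o⇒m≤o b p))
      s = sumP (coefficients ps)
      y = gapSum d δ′ L (gaps q ps)
      e : ∀ {m} r p r′ p′ (a s y : Point m) → ((r + p * r′) · a) ⊕ (((r + p * r′) · s) ⊕ ((p * p′) · y))
        ≡ (r · (a ⊕ s)) ⊕ (p · ((r′ · (a ⊕ s)) ⊕ (p′ · y)))
      e r p r′ p′ []       []       []       = refl
      e r p r′ p′ (a ∷ as) (s ∷ ss) (y ∷ ys) = cong₂ _∷_ (eℤ r p r′ p′ a s y) (e r p r′ p′ as ss ys)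
        where
        eℤ : ∀ r p r′ p′ a s y → (r + p * r′) * a + ((r + p * r′) * s + (p * p′) * y)
           ≡ r * (a + s) + p * (r′ * (a + s) + p′ * y)
        eℤ = solve-∀

    place-sum-gaps₀ : ∀ {T ps} → Increasing T 0 ps → place-sum ps ≡ gapSum d δ′ L (gaps 0 ps)
    place-sum-gaps₀ {ps = ps} i = trans (place-sum-gaps i)
      (trans (cong₂ (λ r p → (r · sumP (coefficients ps)) ⊕ (p · gapSum d δ′ L (gaps 0 ps)))
         (cong (repunit d δ′) (ℕP.*-zeroʳ L)) (cong (D ℤ.^_) (ℕP.*-zeroʳ L)))
       (e (sumP (coefficients ps)) (gapSum d δ′ L (gaps 0 ps))))
      where
      e : ∀ {m} (x y : Point m) → ((+ 0) · x) ⊕ ((+ 1) · y) ≡ y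
      e []       []       = refl
      e (x ∷ xs) (y ∷ ys) = cong₂ _∷_ (trans (ℤP.+-identityˡ (+ 1 * y)) (ℤP.*-identityˡ y)) (e xs ys)

-- Boolean combinations

∈-concatMap : ∀ {A B : Set} (f : A → List B) {x y xs} → x ∈ xs → y ∈ f x → y ∈ concatMap f xs
∈-concatMap f x∈xs y∈fx = ∈P.∈-concatMap⁺ f (lose x∈xs y∈fx)

pos-^ : ∀ a n → (+ a) ℤ.^ n ≡ + (a ℕ.^ n)
pos-^ a zero    = refl
pos-^ a (suc n) = trans (cong (+ a *_) (pos-^ a n)) (sym (ℤP.pos-* a (a ℕ.^ n)))

module _ (d : ℕ) .{{_ : NonZero d}} (δ′ L : ℕ) {m : ℕ} where

  private
    δ = suc δ′
    ev : List (Point m × ℕ) → Point m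
    ev = place-sum d δ′ L
    R = rep d δ′ L
    P = pow d δ′ L

  Family : Set
  Family = Point m × List (Point m)

  -- Places start at 1 because a sum in `C` always has at least one term.
  InFamily : Family → Point m → Set
  InFamily (t , as) x = ∃[ ps ] (coefficients ps ≡ as × All (λ ap → 1 ℕ.≤ proj₂ ap) ps × x ≡ t ⊕ ev ps)

  -- R(L(n+1)) = (1 + d^(δL) + ⋯ + d^(nδL)) R(L), so that the multiples aR(L(n+1)) form C(R(L)a; δL).
  geometric : ℕ → ℕ
  geometric n = sumTo n (λ i → d ℕ.^ (i ℕ.* (δ ℕ.* L)))

  rep-geometric : ∀ n → R (suc n) ≡ + geometric n * R 1
  rep-geometric zero    = sym (ℤP.*-identityˡ (R 1))
  rep-geometric (suc n) = begin
    R (suc (suc n))                                     ≡⟨ cong R (ℕP.+-comm 1 (suc n)) ⟩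
    R (suc n ℕ.+ 1)                                     ≡⟨ rep-+ d δ′ L (suc n) 1 ⟩
    R (suc n) + P (suc n) * R 1                         ≡⟨ cong₂ (λ r p → r + p * R 1) (rep-geometric n) power ⟩
    + geometric n * R 1 + + (d ℕ.^ e) * R 1             ≡⟨ ℤP.*-distribʳ-+ (R 1) (+ geometric n) (+ (d ℕ.^ e)) ⟨
    + geometric (suc n) * R 1                           ∎
    where
    open ≡-Reasoning
    e = suc n ℕ.* (δ ℕ.* L)
    power : P (suc n) ≡ + (d ℕ.^ e)
    power = trans (pos-^ (d ℕ.^ δ) (L ℕ.* suc n)) (cong +_ (trans (ℕP.^-*-assoc d δ (L ℕ.* suc n))
      (cong (d ℕ.^_) (trans (sym (ℕP.*-assoc δ L (suc n))) (ℕP.*-comm (δ ℕ.* L) (suc n))))))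

  module _ (1≤L : 1 ℕ.≤ L) where

    generator : Point m → Gen m
    generator a = (R 1 · a , δ ℕ.* L) , ℕP.*-mono-≤ {1} {δ} (s≤s z≤n) 1≤L

    toAtom : Family → BoolComb m
    toAtom (t , as) = atom t (List.map generator as)

    SumC⁺ : ∀ ps → All (λ ap → 1 ℕ.≤ proj₂ ap) ps → SumC d (List.map generator (coefficients ps)) (ev ps)
    SumC⁺ []                 []       = refl
    SumC⁺ ((a , suc n) ∷ ps) (_ ∷ qs) = _ , _ , (n , trans (cong (_· a) (rep-geometric n)) (·-· (+ geometric n) (R 1) a)) , SumC⁺ ps qs , refl

    SumC⁻ : ∀ as s → SumC d (List.map generator as) s →
      ∃[ ps ] (coefficients ps ≡ as × All (λ ap → 1 ℕ.≤ proj₂ ap) ps × s ≡ ev ps)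
    SumC⁻ []       s p = [] , refl , [] , p
    SumC⁻ (a ∷ as) s (y , z , (n , y≡) , z∈ , s≡) with SumC⁻ as z z∈
    ... | ps , refl , qs , z≡ = (a , suc n) ∷ ps , refl , s≤s z≤n ∷ qs , trans s≡ (cong₂ _⊕_
          (trans y≡ (trans (sym (·-· (+ geometric n) (R 1) a)) (cong (_· a) (sym (rep-geometric n))))) z≡)

    toAtom⁺ : ∀ F {x} → InFamily F x → ⟦ toAtom F ⟧ d x
    toAtom⁺ (t , as) (ps , refl , qs , x≡) = _ , SumC⁺ ps qs , x≡

    toAtom⁻ : ∀ F {x} → ⟦ toAtom F ⟧ d x → InFamily F x
    toAtom⁻ (t , as) (s , s∈ , x≡) with SumC⁻ as s s∈
    ... | ps , cs , qs , s≡ = ps , cs , qs , trans x≡ (cong (t ⊕_) s≡)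

  -- A parameter below `T` has finitely many values, and each contributes a constant that the
  -- translate absorbs.
  drops : ℕ → Family → List Family
  drops T (t , as) = concatMap (λ y → List.map (λ n → t ⊕ (R n · proj₁ y) , proj₂ y) (upTo T)) (picks as)

  -- If q = p + r with r < T, then R(q) = R(r) + P(r) R(p): the coefficient at `q` leaves a constant
  -- multiple of R(r) in the translate and joins the coefficient at `p` with weight P(r).
  merges : ℕ → Family → List Family
  merges T (t , as) = concatMap (λ y → concatMap (λ z →
    List.map (λ r → t ⊕ (R r · proj₁ z) , (proj₁ y ⊕ (P r · proj₁ z)) ∷ proj₂ z) (upTo T)) (picks (proj₂ y))) (picks as)

  reductions : ℕ → Family → List Family
  reductions T F = drops T F ++ merges T F

  picks-length : ∀ {A : Set} {k} (xs : List A) {y ys} → (y , ys) ∈ picks xs → length xs ℕ.≤ suc k → length ys ℕ.≤ k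
  picks-length xs i p = ℕP.≤-pred (subst (ℕ._≤ _) (↭P.↭-length (picks-↭ xs i)) p)

  reductions-length : ∀ T t as {F k} → F ∈ reductions T (t , as) → length as ℕ.≤ suc k → length (proj₂ F) ℕ.≤ k
  reductions-length T t as F∈ p with ∈P.∈-++⁻ (drops T (t , as)) F∈
  ... | inj₁ F∈d with find (∈P.∈-concatMap⁻ _ {xs = picks as} F∈d)
  ...   | y , y∈ , F∈′ with ∈P.∈-map⁻ _ F∈′
  ...     | n , _ , refl = picks-length as y∈ p
  reductions-length T t as F∈ p | inj₂ F∈m with find (∈P.∈-concatMap⁻ _ {xs = picks as} F∈m)
  ...   | y , y∈ , F∈′ with find (∈P.∈-concatMap⁻ _ {xs = picks (proj₂ y)} F∈′)
  ...     | z , z∈ , F∈″ with ∈P.∈-map⁻ _ F∈″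
  ...       | r , _ , refl = subst (ℕ._≤ _) (↭P.↭-length (picks-↭ (proj₂ y) z∈)) (picks-length as y∈ p)

  crowded-reduces : ∀ T t ps → All (λ ap → 1 ℕ.≤ proj₂ ap) ps → Crowded T ps →
    ∃[ F ] (F ∈ reductions T (t , coefficients ps) × InFamily F (t ⊕ ev ps))
  crowded-reduces T t ps qs (low {a} {p} {rest} i p<T) = _ ,
    ∈P.∈-++⁺ˡ (∈-concatMap _ (picks-map proj₁ ps i) (∈P.∈-map⁺ _ (∈P.∈-upTo⁺ p<T))) ,
    rest , refl , All.tail (↭P.All-resp-↭ (picks-↭ ps i) qs) ,
    trans (cong (t ⊕_) (place-sum-↭ d δ′ L (picks-↭ ps i))) (sym (⊕-assoc t _ (ev rest)))
  crowded-reduces T t ps qs (close {a} {p} {rest} {b} {q} {rest′} i j (p≤q , q<p+T)) = _ ,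
    ∈P.∈-++⁺ʳ (drops T (t , coefficients ps)) (∈-concatMap _ (picks-map proj₁ ps i)
      (∈-concatMap _ (picks-map proj₁ rest j) (∈P.∈-map⁺ _ (∈P.∈-upTo⁺ r<T)))) ,
    (a ⊕ (P r · b) , p) ∷ rest′ , refl , All.head tail₁ ∷ All.tail (↭P.All-resp-↭ (picks-↭ rest j) (All.tail tail₁)) ,
    (begin
      t ⊕ ev ps
        ≡⟨ cong (t ⊕_) (place-sum-↭ d δ′ L (↭-trans (picks-↭ ps i) (prep _ (picks-↭ rest j)))) ⟩
      t ⊕ ((R p · a) ⊕ ((R q · b) ⊕ ev rest′))
        ≡⟨ cong (λ k → t ⊕ ((R p · a) ⊕ ((k · b) ⊕ ev rest′))) (trans (cong R (sym (ℕP.m∸n+n≡m p≤q))) (rep-+ d δ′ L r p)) ⟩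
      t ⊕ ((R p · a) ⊕ (((R r + P r * R p) · b) ⊕ ev rest′))
        ≡⟨ e (R p) (R r) (P r) t a b (ev rest′) ⟩
      (t ⊕ (R r · b)) ⊕ ((R p · (a ⊕ (P r · b))) ⊕ ev rest′) ∎)
    where
    open ≡-Reasoning
    r = q ℕ.∸ p
    r<T : r ℕ.< T
    r<T = ℕP.+-cancelˡ-< p r T (subst (ℕ._< p ℕ.+ T) (sym (ℕP.m+[n∸m]≡n p≤q)) q<p+T)
    tail₁ = ↭P.All-resp-↭ (picks-↭ ps i) qs
    e : ∀ {m} u v w (t a b x : Point m) → t ⊕ ((u · a) ⊕ (((v + w * u) · b) ⊕ x))
      ≡ (t ⊕ (v · b)) ⊕ ((u · (a ⊕ (w · b))) ⊕ x)
    e u v w []       []       []       []       = refl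
    e u v w (t ∷ ts) (a ∷ as) (b ∷ bs) (x ∷ xs) = cong₂ _∷_ (eℤ u v w t a b x) (e u v w ts as bs xs)
      where
      eℤ : ∀ u v w t a b x → t + (u * a + ((v + w * u) * b + x)) ≡ (t + v * b) + (u * (a + w * b) + x)
      eℤ = solve-∀

-- Independence of the order under stability, and induction on the number of parameters

module _ (d : ℕ) .{{_ : NonZero d}} (2≤d : 2 ℕ.≤ d) {m : ℕ} (M : DFA d m) (δ′ : ℕ) where

  private
    N = DFA.nStates M
    L = (N ℕ.* N) !
    acc = accepts d 2≤d M
    ev : List (Point m × ℕ) → Point m
    ev = place-sum d δ′ L
    R = rep d δ′ L
    1≤L : 1 ℕ.≤ L
    1≤L = ℕ.>-nonZero⁻¹ L {{(N ℕ.* N) ℕP.!≢0}}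

  abstract
    threshold : List (Point m) → Point m → ℕ
    threshold as t = proj₁ (accepts-constant d 2≤d M δ′ as t)

    verdict : List (Point m) → Point m → Bool
    verdict as t = proj₁ (proj₂ (accepts-constant d 2≤d M δ′ as t))

    accepts-verdict : ∀ {as} t {ps T} → coefficients ps ≡ as → threshold as t ℕ.≤ T → Increasing T 0 ps →
      acc (t ⊕ ev ps) ≡ verdict as t
    accepts-verdict {as} t {ps} cs T≤ inc = trans (cong (λ x → acc (t ⊕ x)) (place-sum-gaps₀ d δ′ L inc))
      (proj₂ (proj₂ (accepts-constant d 2≤d M δ′ as t)) (gaps d δ′ L 0 ps)
        (trans (coefficients-gaps d δ′ L 0 ps) cs) (gaps-wide d δ′ L (Increasing-weaken T≤ inc)))

  module _ (A : Subset m) (A⇒acc : ∀ x → A x → acc x ≡ true) (acc⇒A : ∀ x → acc x ≡ true → A x) (stable : StableIn A) where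

    -- If interchanging a and b turned membership off, then interleaving the places
    -- of a with those of b would give ladders of every length.
    verdict-swap-true : ∀ as a b bs t → verdict (as ++ a ∷ b ∷ bs) t ≡ true → verdict (as ++ b ∷ a ∷ bs) t ≡ true
    verdict-swap-true as a b bs t v≡true = BoolP.¬-not λ v′≡false → proj₂ stable (ladder v′≡false)
      where
      K = proj₁ stable
      T = threshold (as ++ a ∷ b ∷ bs) t ℕ.⊔ threshold (as ++ b ∷ a ∷ bs) t
      prefix = spread T 0 as
      base = spread-end T 0 as ℕ.+ T
      pos = λ k → base ℕ.+ k ℕ.* T
      -- The interleaved coefficients occupy slots 0 to 2K + 1, so the remaining ones begin beyond
      -- slot 2K + 1.
      suffix = spread T (pos (suc (K ℕ.+ K))) bs
      pos-< : ∀ {k l} → k ℕ.< l → pos k ℕ.+ T ℕ.≤ pos l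
      pos-< {k} {l} k<l = ℕP.≤-trans (ℕP.≤-reflexive (trans (ℕP.+-assoc base (k ℕ.* T) T) (cong (base ℕ.+_) (ℕP.+-comm (k ℕ.* T) T))))
        (ℕP.+-monoʳ-≤ base (ℕP.*-monoˡ-≤ T k<l))
      pos-≤ : ∀ {k l} → k ℕ.≤ l → pos k ℕ.≤ pos l
      pos-≤ k≤l = ℕP.+-monoʳ-≤ base (ℕP.*-monoˡ-≤ T k≤l)
      value-at : ∀ a b k l → k ℕ.< l → l ℕ.≤ suc (K ℕ.+ K) → threshold (as ++ a ∷ b ∷ bs) t ℕ.≤ T →
        acc (t ⊕ ev (prefix ++ (a , pos k) ∷ (b , pos l) ∷ suffix)) ≡ verdict (as ++ a ∷ b ∷ bs) t
      value-at a b k l k<l l≤ T≤ = accepts-verdict t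
        (trans (ListP.map-++ proj₁ prefix _) (cong₂ (λ x y → x ++ a ∷ b ∷ y) (coefficients-spread T 0 as) (coefficients-spread T _ bs)))
        T≤ (spread-increasing T 0 as (ℕP.m≤m+n base (k ℕ.* T) ∷ pos-< k<l ∷ Increasing-lower (pos-≤ l≤)
             (subst (Increasing T _) (ListP.++-identityʳ suffix) (spread-increasing T (pos (suc (K ℕ.+ K))) bs []))))
      -- `a` takes the even slots 2i and `b` the odd slots 2j + 1. As 2i < 2j + 1 exactly when i ≤
      -- j, the order of the two in the sum of `x i` and `y j` records the comparison that a ladder
      -- asks for.
      x : Fin (suc K) → Point m
      x i = t ⊕ (ev prefix ⊕ (R (pos (toℕ i ℕ.+ toℕ i)) · a))
      y : Fin (suc K) → Point m
      y j = (R (pos (suc (toℕ j ℕ.+ toℕ j))) · b) ⊕ ev suffix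
      split : ∀ p u v s → (t ⊕ (p ⊕ u)) ⊕ (v ⊕ s) ≡ t ⊕ (p ⊕ (u ⊕ (v ⊕ s)))
      split p u v s = trans (⊕-assoc t (p ⊕ u) (v ⊕ s)) (cong (t ⊕_) (⊕-assoc p u (v ⊕ s)))
      sum-ab : ∀ i j → x i ⊕ y j ≡ t ⊕ ev (prefix ++ (a , pos (toℕ i ℕ.+ toℕ i)) ∷ (b , pos (suc (toℕ j ℕ.+ toℕ j))) ∷ suffix)
      sum-ab i j = trans (split (ev prefix) _ _ (ev suffix)) (cong (t ⊕_) (sym (place-sum-++ d δ′ L prefix _)))
      sum-ba : ∀ i j → x i ⊕ y j ≡ t ⊕ ev (prefix ++ (b , pos (suc (toℕ j ℕ.+ toℕ j))) ∷ (a , pos (toℕ i ℕ.+ toℕ i)) ∷ suffix)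
      sum-ba i j = trans (split (ev prefix) _ _ (ev suffix)) (cong (t ⊕_)
        (trans (cong (ev prefix ⊕_) (⊕-swap _ _ (ev suffix))) (sym (place-sum-++ d δ′ L prefix _))))
      ≤K : ∀ (i : Fin (suc K)) → toℕ i ℕ.≤ K
      ≤K = FinP.toℕ≤pred[n]
      ladder : verdict (as ++ b ∷ a ∷ bs) t ≡ false → Ladder (λ x y → A (x ⊕ y)) K
      ladder v′≡false = x , y , λ i j → forth i j , back i j
        where
        back : ∀ i j → toℕ i ℕ.≤ toℕ j → A (x i ⊕ y j)
        back i j i≤j = acc⇒A _ (trans (cong acc (sum-ab i j)) (trans
          (value-at a b _ _ (s≤s (ℕP.+-mono-≤ i≤j i≤j)) (s≤s (ℕP.+-mono-≤ (≤K j) (≤K j))) (ℕP.m≤m⊔n _ _)) v≡true))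
        forth : ∀ i j → A (x i ⊕ y j) → toℕ i ℕ.≤ toℕ j
        forth i j xy∈A = ℕP.≮⇒≥ λ j<i → contradiction (trans (sym (A⇒acc _ xy∈A)) (trans (cong acc (sum-ba i j)) (trans
          (value-at b a _ _ (subst (ℕ._≤ toℕ i ℕ.+ toℕ i) (ℕP.+-suc (suc (toℕ j)) (toℕ j)) (ℕP.+-mono-≤ j<i j<i))
            (ℕP.m≤n⇒m≤1+n (ℕP.+-mono-≤ (≤K i) (≤K i))) (ℕP.m≤n⊔m (threshold (as ++ a ∷ b ∷ bs) t) _)) v′≡false))) λ ()

    verdict-swap : ∀ as a b bs t → verdict (as ++ a ∷ b ∷ bs) t ≡ verdict (as ++ b ∷ a ∷ bs) t
    verdict-swap as a b bs t = BoolP.⇔→≡ (mk⇔ (verdict-swap-true as a b bs t) (verdict-swap-true as b a bs t))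

    -- The prefix `as` collects the entries skipped by `prep`, so that every transposition met
    -- inside the permutation has the shape required by `verdict-swap`.
    verdict-↭ : ∀ {xs ys} → xs ↭ ys → ∀ as t → verdict (as ++ xs) t ≡ verdict (as ++ ys) t
    verdict-↭ ↭.refl       as t = refl
    verdict-↭ (↭.trans p q) as t = trans (verdict-↭ p as t) (verdict-↭ q as t)
    verdict-↭ (prep {xs} {ys} x p) as t = subst₂ (λ u v → verdict u t ≡ verdict v t)
      (ListP.++-assoc as (x ∷ []) xs) (ListP.++-assoc as (x ∷ []) ys) (verdict-↭ p (as ++ x ∷ []) t)
    verdict-↭ (swap {xs} {ys} x y p) as t = trans
      (subst₂ (λ u v → verdict u t ≡ verdict v t)
        (ListP.++-assoc as (x ∷ y ∷ []) xs) (ListP.++-assoc as (x ∷ y ∷ []) ys) (verdict-↭ p (as ++ x ∷ y ∷ []) t))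
      (verdict-swap as x y ys t)

    -- The part of e outside the family only has to stay inside A, which spares proving
    -- that the reductions of a family are contained in it.
    Approximates : Family d δ′ L → BoolComb m → Set
    Approximates F e = (∀ x → InFamily d δ′ L F x → acc x ≡ true → ⟦ e ⟧ d x) × (∀ x → ⟦ e ⟧ d x → acc x ≡ true)

    emptySet : BoolComb m
    emptySet = inter (atom 𝟘 []) (compl (atom 𝟘 []))

    union-of : ∀ Fs → (∀ {F} → F ∈ Fs → ∃[ e ] Approximates F e) →
      ∃[ e ] ((∀ {F} → F ∈ Fs → ∀ x → InFamily d δ′ L F x → acc x ≡ true → ⟦ e ⟧ d x) × (∀ x → ⟦ e ⟧ d x → acc x ≡ true))
    union-of []       approx = emptySet , (λ ()) , λ x p → contradiction (proj₁ p) (proj₂ p)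
    union-of (F ∷ Fs) approx with approx (here refl) | union-of Fs (approx ∘ there)
    ... | e , in-e , e⊆ | es , in-es , es⊆ = union e es ,
      (λ { (here refl) x p q → inj₁ (in-e x p q) ; (there i) x p q → inj₂ (in-es i x p q) }) ,
      λ x → [ e⊆ x , es⊆ x ]′

    -- Stating ¬ A through compl e keeps the combination below constructive: membership in
    -- a family need not be decided.
    exceptions : ∀ Fs → (∀ {F} → F ∈ Fs → ∃[ e ] Approximates F e) →
      ∃[ e ] ((∀ {F} → F ∈ Fs → ∀ x → InFamily d δ′ L F x → acc x ≡ false → ⟦ e ⟧ d x) × (∀ x → ⟦ e ⟧ d x → acc x ≢ true))
    exceptions []       approx = emptySet , (λ ()) , λ x p → contradiction (proj₁ p) (proj₂ p)
    exceptions (F ∷ Fs) approx with approx (here refl) | exceptions Fs (approx ∘ there)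
    ... | e , in-e , e⊆ | es , in-es , es⊆ = union (inter (toAtom d δ′ L 1≤L F) (compl e)) es ,
      (λ { (here refl) x p q → inj₁ (toAtom⁺ d δ′ L 1≤L F p , λ x∈e → contradiction (trans (sym q) (e⊆ x x∈e)) λ ())
         ; (there i) x p q → inj₂ (in-es i x p q) }) ,
      λ x → [ (λ p q → proj₂ p (in-e x (toAtom⁻ d δ′ L 1≤L F (proj₁ p)) q)) , es⊆ x ]′

    -- Sorting the places may bring the coefficients into any order, so the threshold has to suit
    -- all of them.
    uniform-threshold : Family d δ′ L → ℕ
    uniform-threshold (t , as) = max 0 (List.map (λ bs → threshold bs t) (permutations as))

    sorted-verdict : ∀ t ps {qs} → let as = coefficients ps in qs ↭ ps → Increasing (uniform-threshold (t , as)) 0 qs →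
      coefficients qs ∈ permutations as → acc (t ⊕ ev ps) ≡ verdict as t
    sorted-verdict t ps {qs} perm inc ∈perms = begin
      acc (t ⊕ ev ps)              ≡⟨ cong (λ x → acc (t ⊕ x)) (place-sum-↭ d δ′ L perm) ⟨
      acc (t ⊕ ev qs)              ≡⟨ accepts-verdict t refl (All.lookup (xs≤max 0 _) (∈P.∈-map⁺ _ ∈perms)) inc ⟩
      verdict (coefficients qs) t  ≡⟨ verdict-↭ (↭P.map⁺ proj₁ perm) [] t ⟩
      verdict (coefficients ps) t  ∎
      where open ≡-Reasoning

    -- A point of the family either has well separated places, where acceptance equals the verdict,
    -- or lies in a reduction with fewer parameters. If the verdict is true, the rejected points to
    -- be removed all lie in reductions; if it is false, all the accepted points do.
    family-combination : ∀ k F → length (proj₂ F) ℕ.≤ k → ∃[ e ] Approximates F e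
    family-combination k (t , as) len≤ = combine (verdict as t) refl
      where
      F = (t , as)
      T = uniform-threshold F
      smaller : ∀ k as → length as ℕ.≤ k → ∀ {F} → F ∈ reductions d δ′ L T (t , as) → ∃[ e ] Approximates F e
      -- Without parameters there is nothing to drop or merge, so the induction ends here.
      smaller k       []       _ ()
      smaller (suc k) (a ∷ as) p i = family-combination k _ (reductions-length d δ′ L T t (a ∷ as) i p)
      combine : ∀ v → verdict as t ≡ v → ∃[ e ] Approximates F e
      combine true v≡ with exceptions (reductions d δ′ L T F) (smaller k as len≤)
      ... | e , in-e , e⊆ = inter (toAtom d δ′ L 1≤L F) (compl e) ,
        (λ x x∈F x∈A → toAtom⁺ d δ′ L 1≤L F x∈F , λ x∈e → e⊆ x x∈e x∈A) ,
        λ x x∈ → decide x (toAtom⁻ d δ′ L 1≤L F (proj₁ x∈)) (proj₂ x∈) (acc x) refl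
        where
        -- Acceptance is a Boolean, so the case of a rejected `x` can be examined: its places would
        -- be crowded, which puts it into `e`.
        decide : ∀ x → InFamily d δ′ L F x → ¬ ⟦ e ⟧ d x → ∀ b → acc x ≡ b → acc x ≡ true
        decide x x∈F x∉e true  eq = eq
        decide x (ps , refl , qs , refl) x∉e false eq with sort-or-crowded T ps
        ... | inj₁ (rs , perm , inc , ∈perms) = trans (sorted-verdict t ps perm inc ∈perms) v≡
        ... | inj₂ crowded = let G , G∈ , x∈G = crowded-reduces d δ′ L T t ps qs crowded in
                             contradiction (in-e G∈ x x∈G eq) x∉e
      combine false v≡ with union-of (reductions d δ′ L T F) (smaller k as len≤)
      ... | e , in-e , e⊆ = e , covered , e⊆
        where
        covered : ∀ x → InFamily d δ′ L F x → acc x ≡ true → ⟦ e ⟧ d x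
        covered x (ps , refl , qs , refl) x∈A with sort-or-crowded T ps
        ... | inj₁ (rs , perm , inc , ∈perms) = contradiction
              (trans (sym x∈A) (trans (sorted-verdict t ps perm inc ∈perms) v≡)) λ ()
        ... | inj₂ crowded = let G , G∈ , x∈G = crowded-reduces d δ′ L T t ps qs crowded in in-e G∈ x x∈G x∈A

-- Loops of sparse automata

n<2^n : ∀ n → n ℕ.< 2 ℕ.^ n
n<2^n zero    = s≤s z≤n
n<2^n (suc n) = ℕP.≤-trans (s≤s (n<2^n n)) (ℕP.+-mono-≤ (ℕP.m^n>0 2 n) (ℕP.≤-reflexive (sym (ℕP.+-identityʳ _))))

exponential-dominates : ∀ c e A B → ∃[ j ] c ℕ.* (A ℕ.+ j ℕ.* B) ℕ.^ e ℕ.< 2 ℕ.^ j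
exponential-dominates c e A B = 2 ℕ.^ n , (begin-strict
  c ℕ.* (A ℕ.+ 2 ℕ.^ n ℕ.* B) ℕ.^ e               ≤⟨ ℕP.*-mono-≤ (ℕP.<⇒≤ (n<2^n c)) (ℕP.^-monoˡ-≤ e base) ⟩
  2 ℕ.^ c ℕ.* (2 ℕ.^ (n ℕ.+ s)) ℕ.^ e             ≡⟨ cong (2 ℕ.^ c ℕ.*_) (ℕP.^-*-assoc 2 (n ℕ.+ s) e) ⟩
  2 ℕ.^ c ℕ.* 2 ℕ.^ ((n ℕ.+ s) ℕ.* e)             ≡⟨ ℕP.^-distribˡ-+-* 2 c ((n ℕ.+ s) ℕ.* e) ⟨
  2 ℕ.^ (c ℕ.+ (n ℕ.+ s) ℕ.* e)                   <⟨ ℕP.^-monoʳ-< 2 (s≤s (s≤s z≤n)) exponent ⟩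
  2 ℕ.^ (2 ℕ.^ n)                                 ∎)
  where
  open ℕP.≤-Reasoning
  s = A ℕ.+ B
  -- With 2ⁿ in the role of j it remains to get c + (n + s)e below 2ⁿ. For n = 3k the left side is
  -- at most k + 3k², while 2ⁿ is the cube of 2ᵏ and so at least (k + 1)³.
  k = c ℕ.+ s ℕ.* e ℕ.+ e
  n = k ℕ.* 3
  base : A ℕ.+ 2 ℕ.^ n ℕ.* B ℕ.≤ 2 ℕ.^ (n ℕ.+ s)
  base = begin
    A ℕ.+ 2 ℕ.^ n ℕ.* B              ≤⟨ ℕP.+-monoˡ-≤ _ (ℕP.m≤n*m A (2 ℕ.^ n) {{ℕP.m^n≢0 2 n}}) ⟩
    2 ℕ.^ n ℕ.* A ℕ.+ 2 ℕ.^ n ℕ.* B  ≡⟨ ℕP.*-distribˡ-+ (2 ℕ.^ n) A B ⟨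
    2 ℕ.^ n ℕ.* s                    ≤⟨ ℕP.*-monoʳ-≤ (2 ℕ.^ n) (ℕP.<⇒≤ (n<2^n s)) ⟩
    2 ℕ.^ n ℕ.* 2 ℕ.^ s              ≡⟨ ℕP.^-distribˡ-+-* 2 n s ⟨
    2 ℕ.^ (n ℕ.+ s)                  ∎
  cube : ∀ k → suc (k ℕ.+ 3 ℕ.* (k ℕ.* k)) ℕ.≤ (suc k) ℕ.^ 3
  cube k = ℕP.≤-trans (ℕP.m≤m+n _ (k ℕ.* k ℕ.* k ℕ.+ (k ℕ.+ k))) (ℕP.≤-reflexive (identity k))
    where
    identity : ∀ k → suc (k ℕ.+ 3 ℕ.* (k ℕ.* k)) ℕ.+ (k ℕ.* k ℕ.* k ℕ.+ (k ℕ.+ k)) ≡ suc k ℕ.* (suc k ℕ.* (suc k ℕ.* 1))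
    identity = ℕSolver.solve-∀
  e≤k : e ℕ.≤ k
  e≤k = ℕP.m≤n+m e (c ℕ.+ s ℕ.* e)
  exponent : c ℕ.+ (n ℕ.+ s) ℕ.* e ℕ.< 2 ℕ.^ n
  exponent = begin-strict
    c ℕ.+ (n ℕ.+ s) ℕ.* e                        ≡⟨ regroup c k s e ⟩
    c ℕ.+ s ℕ.* e ℕ.+ 3 ℕ.* (k ℕ.* e)            ≤⟨ ℕP.+-mono-≤ (ℕP.m≤m+n (c ℕ.+ s ℕ.* e) e) (ℕP.*-monoʳ-≤ 3 (ℕP.*-monoʳ-≤ k e≤k)) ⟩
    k ℕ.+ 3 ℕ.* (k ℕ.* k)                        <⟨ cube k ⟩
    suc k ℕ.^ 3                                  ≤⟨ ℕP.^-monoˡ-≤ 3 (n<2^n k) ⟩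
    (2 ℕ.^ k) ℕ.^ 3                              ≡⟨ ℕP.^-*-assoc 2 k 3 ⟩
    2 ℕ.^ n                                      ∎
    where
    regroup : ∀ c k s e → c ℕ.+ (k ℕ.* 3 ℕ.+ s) ℕ.* e ≡ c ℕ.+ s ℕ.* e ℕ.+ 3 ℕ.* (k ℕ.* e)
    regroup = ℕSolver.solve-∀

module _ {A : Set} where

  prefix-of : ∀ (zs xs : List A) {ws ys} → xs ++ ys ≡ zs ++ ws → length zs ℕ.≤ length xs → ∃[ k ] xs ≡ zs ++ k
  prefix-of []       xs       eq _ = xs , refl
  prefix-of (z ∷ zs) (x ∷ xs) eq (s≤s p) with prefix-of zs xs (ListP.∷-injectiveʳ eq) p
  ... | k , refl = k , cong (_∷ _) (ListP.∷-injectiveˡ eq)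

  ++-injectiveˡ : ∀ (xs ys : List A) {us vs} → length xs ≡ length ys → xs ++ us ≡ ys ++ vs → xs ≡ ys
  ++-injectiveˡ []       []       _ _  = refl
  ++-injectiveˡ (x ∷ xs) (y ∷ ys) p eq = cong₂ _∷_ (ListP.∷-injectiveˡ eq) (++-injectiveˡ xs ys (ℕP.suc-injective p) (ListP.∷-injectiveʳ eq))

  power : List A → ℕ → List A
  power w zero    = []
  power w (suc k) = w ++ power w k

  length-power : ∀ w k → length (power w k) ≡ k ℕ.* length w
  length-power w zero    = refl
  length-power w (suc k) = trans (ListP.length-++ w) (cong (length w ℕ.+_) (length-power w k))

  power-+ : ∀ w j k → power w (j ℕ.+ k) ≡ power w j ++ power w k
  power-+ w zero    k = refl
  power-+ w (suc j) k = trans (cong (w ++_) (power-+ w j k)) (sym (ListP.++-assoc w (power w j) (power w k)))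

  power-* : ∀ w j k → power (power w j) k ≡ power w (j ℕ.* k)
  power-* w j zero    = cong (power w) (sym (ℕP.*-zeroʳ j))
  power-* w j (suc k) = trans (cong (power w j ++_) (power-* w j k))
    (trans (sym (power-+ w j (j ℕ.* k))) (cong (power w) (sym (ℕP.*-suc j k))))

  lookup-injective : ∀ {xs : List A} → Unique xs → ∀ i j → List.lookup xs i ≡ List.lookup xs j → i ≡ j
  lookup-injective (_ ∷ _)     Fin.zero    Fin.zero    _  = refl
  lookup-injective (x∉xs ∷ _)  Fin.zero    (Fin.suc j) eq = contradiction eq (All.lookup x∉xs (∈P.∈-lookup j))
  lookup-injective (x∉xs ∷ _)  (Fin.suc i) Fin.zero    eq = contradiction (sym eq) (All.lookup x∉xs (∈P.∈-lookup i))
  lookup-injective (_ ∷ u)     (Fin.suc i) (Fin.suc j) eq = cong Fin.suc (lookup-injective u i j eq)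

Unique-length : ∀ {n} {xs : List (Fin n)} → Unique xs → length xs ℕ.≤ n
Unique-length u = FinP.injective⇒≤ (lookup-injective u _ _)

module _ {d : ℕ} where

  SDigit-ext : {a b : SDigit d} → proj₁ a ≡ proj₁ b → a ≡ b
  SDigit-ext {a , _} refl = cong (a ,_) (ℕP.<-irrelevant _ _)

  _≟-Letter_ : ∀ {m} → DecidableEquality (Letter d m)
  _≟-Letter_ = VecP.≡-dec λ a b → map′ SDigit-ext (cong proj₁) (proj₁ a ℤP.≟ proj₁ b)

  _≟-Word_ : ∀ {m} → DecidableEquality (Word d m)
  _≟-Word_ = ListP.≡-dec _≟-Letter_

  digits : List (SDigit d)
  digits = List.map (λ i → posD (toℕ i , FinP.toℕ<n i)) (allFin d) ++ List.map (λ i → negD (toℕ i , FinP.toℕ<n i)) (allFin d)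

  ∈-digits : ∀ a → a ∈ digits
  ∈-digits (+ n , p) = ∈P.∈-++⁺ˡ (subst (_∈ List.map pos (allFin d))
    (SDigit-ext (cong +_ (FinP.toℕ-fromℕ< p))) (∈P.∈-map⁺ pos (∈P.∈-allFin (Fin.fromℕ< p))))
    where
    pos : Fin d → SDigit d
    pos i = posD (toℕ i , FinP.toℕ<n i)
  ∈-digits (-[1+ n ] , p) = ∈P.∈-++⁺ʳ _ (subst (_∈ List.map neg (allFin d))
    (SDigit-ext (value-negD (FinP.toℕ<n (Fin.fromℕ< p)) (FinP.toℕ-fromℕ< p))) (∈P.∈-map⁺ neg (∈P.∈-allFin (Fin.fromℕ< p))))
    where
    neg : Fin d → SDigit d
    neg i = negD (toℕ i , FinP.toℕ<n i)
    value-negD : ∀ {k n} (p : k ℕ.< d) → k ≡ suc n → proj₁ (negD (k , p)) ≡ -[1+ n ]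
    value-negD p refl = refl

  letters : ∀ m → List (Letter d m)
  letters zero    = [] ∷ []
  letters (suc m) = cartesianProductWith _∷_ digits (letters m)

  ∈-letters : ∀ {m} (ℓ : Letter d m) → ℓ ∈ letters m
  ∈-letters []      = here refl
  ∈-letters (a ∷ ℓ) = ∈P.∈-cartesianProductWith⁺ _∷_ (∈-digits a) (∈-letters ℓ)

  words : ∀ m → ℕ → List (Word d m)
  words m zero    = [] ∷ []
  words m (suc k) = [] ∷ cartesianProductWith _∷_ (letters m) (words m k)

  ∈-words : ∀ {m} k (w : Word d m) → length w ℕ.≤ k → w ∈ words m k
  ∈-words zero    []      _       = here refl
  ∈-words (suc k) []      _       = here refl
  ∈-words (suc k) (ℓ ∷ w) (s≤s p) = there (∈P.∈-cartesianProductWith⁺ _∷_ (∈-letters ℓ) (∈-words k w p))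

module Loops {d m : ℕ} (M : DFA d m) where
  open DFA M

  private
    N = nStates
    State = Fin N

  Accepting : State → Word d m → Set
  Accepting q w = accept (foldl step q w) ≡ true

  Loop : State → Word d m → Set
  Loop q w = foldl step q w ≡ q

  loop-++ : ∀ {q} u {w} → Loop q u → foldl step q (u ++ w) ≡ foldl step q w
  loop-++ {q} u {w} p = trans (ListP.foldl-++ step q u w) (cong (λ q → foldl step q w) p)

  loop-power : ∀ {q} w → Loop q w → ∀ k → Loop q (power w k)
  loop-power w p zero    = refl
  loop-power w p (suc k) = trans (loop-++ w p) (loop-power w p k)

  -- A loop longer than the number of states repeats a state, and the piece between the two
  -- occurrences can be cut out.
  shorten : ∀ fuel q l → length l ℕ.≤ fuel → Loop q l → 1 ℕ.≤ length l →
    ∃[ u ] (Loop q u × 1 ℕ.≤ length u × length u ℕ.≤ N)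
  shorten fuel q l l≤ loop l≥1 with length l ℕP.≤? N
  ... | yes l≤N = l , loop , l≥1 , l≤N
  shorten zero q l l≤ loop l≥1 | no l≰N = contradiction (ℕP.≤-trans l≥1 l≤) λ ()
  shorten (suc fuel) q l l≤ loop l≥1 | no l≰N
    -- Only nonempty prefixes are compared, so the first letter survives the cut and the loop does
    -- not become empty.
    with FinP.pigeonhole (ℕP.n<1+n N) (λ i → foldl step q (take (suc (toℕ i)) l))
  ... | i , j , i<j , eq = shorten fuel q cut
        (ℕP.≤-pred (ℕP.≤-trans cut< l≤)) cut-loop (ℕP.≤-trans (s≤s z≤n) (ℕP.≤-reflexive (sym length-cut)))
    where
    i′ = suc (toℕ i)
    j′ = suc (toℕ j)
    j′≤ : j′ ℕ.≤ length l
    j′≤ = ℕP.≤-trans (FinP.toℕ<n j) (ℕP.≰⇒> l≰N)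
    cut = take i′ l ++ drop j′ l
    length-cut : length cut ≡ i′ ℕ.+ (length l ℕ.∸ j′)
    length-cut = trans (ListP.length-++ (take i′ l)) (cong₂ ℕ._+_
      (trans (ListP.length-take i′ l) (ℕP.m≤n⇒m⊓n≡m (ℕP.≤-trans (ℕP.<⇒≤ (s≤s i<j)) j′≤))) (ListP.length-drop j′ l))
    cut< : length cut ℕ.< length l
    cut< = subst₂ ℕ._<_ (sym length-cut) (ℕP.m+[n∸m]≡n j′≤) (ℕP.+-monoˡ-< (length l ℕ.∸ j′) (s≤s i<j))
    cut-loop : Loop q cut
    cut-loop = begin
      foldl step q (take i′ l ++ drop j′ l)               ≡⟨ ListP.foldl-++ step q (take i′ l) _ ⟩
      foldl step (foldl step q (take i′ l)) (drop j′ l)   ≡⟨ cong (λ q → foldl step q (drop j′ l)) eq ⟩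
      foldl step (foldl step q (take j′ l)) (drop j′ l)   ≡⟨ ListP.foldl-++ step q (take j′ l) _ ⟨
      foldl step q (take j′ l ++ drop j′ l)               ≡⟨ cong (foldl step q) (ListP.take++drop≡id j′ l) ⟩
      foldl step q l                                      ≡⟨ loop ⟩
      q                                                   ∎
      where open ≡-Reasoning

  LoopSearch : ℕ → State → Set
  LoopSearch ℓ q = (∃[ w ] (length w ≡ ℓ × Loop q w)) ⊎ (∀ w → Loop q w → w ≡ [])

  -- If there is any nonempty loop at `q`, there is one of length at most N, and a power of it has
  -- length exactly `ℓ`. A search through finitely many words therefore settles the alternative.
  loop-search : ∀ {ℓ} → (∀ {k} → 1 ℕ.≤ k → k ℕ.≤ N → k ∣ ℓ) → ∀ q → LoopSearch ℓ q
  loop-search {ℓ} divisible q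
    with any? (λ w → (1 ℕP.≤? length w) ×-dec (length w ℕP.≤? N) ×-dec (foldl step q w FinP.≟ q)) (words m N)
  ... | yes found = let u , _ , u≥1 , u≤N , loop = find found in power-loop u loop (divisible u≥1 u≤N)
    where
    power-loop : ∀ u → Loop q u → length u ∣ ℓ → LoopSearch ℓ q
    power-loop u loop (divides k ℓ≡) = inj₁ (power u k , trans (length-power u k) (sym ℓ≡) , loop-power u loop k)
  ... | no none = inj₂ λ
    { []      loop → refl
    ; (a ∷ w) loop → let u , loop′ , u≥1 , u≤N = shorten _ q (a ∷ w) ℕP.≤-refl loop (s≤s z≤n) in
        contradiction (lose (∈-words N u u≤N) (u≥1 , u≤N , loop′)) none }

  Avoids : List State → State → Word d m → Set
  Avoids V q []      = q ∉ V
  Avoids V q (a ∷ w) = q ∉ V × Avoids V (step q a) w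

  avoids-head : ∀ {V q} w → Avoids V q w → q ∉ V
  avoids-head []      p = p
  avoids-head (a ∷ w) p = proj₁ p

  -- The initial state is exempt: in use it is the state just added to `V`.
  AvoidsAfter : List State → State → Word d m → Set
  AvoidsAfter V q []      = ⊤
  AvoidsAfter V q (a ∷ w) = Avoids V (step q a) w

  -- Cutting at the last visit puts all returns to `p` into `l`. The rest never meets `p` again, so
  -- each state serves at most once as the base of a loop, which bounds the depth of the cover.
  last-visit : ∀ p V q w → Avoids V q w →
    (∃[ l ] ∃[ w′ ] (w ≡ l ++ w′ × foldl step q l ≡ p × AvoidsAfter (p ∷ V) p w′)) ⊎ Avoids (p ∷ V) q w
  last-visit p V q [] av with q FinP.≟ p
  ... | yes q≡p = inj₁ ([] , [] , refl , q≡p , tt)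
  ... | no q≢p = inj₂ λ { (here q≡p) → q≢p q≡p ; (there q∈V) → av q∈V }
  last-visit p V q (a ∷ w) (q∉V , av) with last-visit p V (step q a) w av
  ... | inj₁ (l , w′ , refl , to-p , av′) = inj₁ (a ∷ l , w′ , refl , to-p , av′)
  ... | inj₂ av′ with q FinP.≟ p
  ...   | yes refl = inj₁ ([] , a ∷ w , refl , refl , av′)
  ...   | no q≢p = inj₂ ((λ { (here q≡p) → q≢p q≡p ; (there q∈V) → q∉V q∈V }) , av′)

  module _ (c e : ℕ) (bounded : ∀ k ws → Unique ws → All (λ w → Accepting start w × length w ℕ.≤ k) ws →
                                length ws ℕ.≤ c ℕ.* suc k ℕ.^ e) where

    -- Two loops u ≠ v of equal length give 2ʲ accepted words p{u,v}ʲs of length linear in j.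
    loops-unique : ∀ p s u v → let q = foldl step start p in Accepting q s → Loop q u → Loop q v →
      length u ≡ length v → u ≡ v
    loops-unique p s u v s-acc u-loop v-loop u≡v = decidable-stable (u ≟-Word v) λ u≢v →
      let j , 2ʲ> = exponential-dominates c e (suc (length p ℕ.+ length s)) (length u) in
      ℕP.<⇒≱ 2ʲ> (subst₂ ℕ._≤_ (trans (ListP.length-map (p ++_) (strands j)) (length-strands j))
        (cong (λ k → c ℕ.* suc k ℕ.^ e) (regroup (length p) (length s) (j ℕ.* length u)))
        (bounded (length p ℕ.+ (j ℕ.* length u ℕ.+ length s)) (List.map (p ++_) (strands j))
          (UniqueP.map⁺ (ListP.++-cancelˡ p _ _) (strands-unique u≢v j))
          (AllP.map⁺ (All.map (λ {w} (acc , len) → trans (cong accept (ListP.foldl-++ step start p w)) acc ,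
            ℕP.≤-reflexive (trans (ListP.length-++ p) (cong (length p ℕ.+_) len))) (strands-accepted j)))))
      where
      q = foldl step start p
      regroup : ∀ p s u → p ℕ.+ (u ℕ.+ s) ≡ p ℕ.+ s ℕ.+ u
      regroup = ℕSolver.solve-∀
      strands : ℕ → List (Word d m)
      strands zero    = s ∷ []
      strands (suc j) = List.map (u ++_) (strands j) ++ List.map (v ++_) (strands j)
      length-strands : ∀ j → length (strands j) ≡ 2 ℕ.^ j
      length-strands zero    = refl
      length-strands (suc j) = trans (ListP.length-++ (List.map (u ++_) (strands j))) (cong₂ ℕ._+_
        (trans (ListP.length-map _ (strands j)) (length-strands j))
        (trans (trans (ListP.length-map _ (strands j)) (length-strands j)) (sym (ℕP.+-identityʳ _))))
      strands-unique : u ≢ v → ∀ j → Unique (strands j)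
      strands-unique u≢v zero    = [] ∷ []
      strands-unique u≢v (suc j) = UniqueP.++⁺
        (UniqueP.map⁺ (ListP.++-cancelˡ u _ _) (strands-unique u≢v j))
        (UniqueP.map⁺ (ListP.++-cancelˡ v _ _) (strands-unique u≢v j))
        λ (i , i′) → let _ , _ , eq = ∈P.∈-map⁻ (u ++_) i ; _ , _ , eq′ = ∈P.∈-map⁻ (v ++_) i′ in
          u≢v (++-injectiveˡ u v u≡v (trans (sym eq) eq′))
      extend : ∀ t j → Loop q t → length u ≡ length t → ∀ {w} → Accepting q w × length w ≡ j ℕ.* length u ℕ.+ length s →
        Accepting q (t ++ w) × length (t ++ w) ≡ suc j ℕ.* length u ℕ.+ length s
      extend t j loop len (acc , w≡) = trans (cong accept (loop-++ t loop)) acc ,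
        trans (ListP.length-++ t) (trans (cong₂ ℕ._+_ (sym len) w≡) (sym (ℕP.+-assoc (length u) (j ℕ.* length u) (length s))))
      strands-accepted : ∀ j → All (λ w → Accepting q w × length w ≡ j ℕ.* length u ℕ.+ length s) (strands j)
      strands-accepted zero    = (s-acc , refl) ∷ []
      strands-accepted (suc j) = AllP.++⁺
        (AllP.map⁺ (All.map (extend u j u-loop refl) (strands-accepted j)))
        (AllP.map⁺ (All.map (extend v j v-loop u≡v) (strands-accepted j)))

    -- The loops `l ++ w` and `w ++ l` have equal length, hence coincide by `loops-unique`; so `w`
    -- is a prefix of `l` as soon as it is not longer, and it can be split off repeatedly.
    loop-decompose : ∀ p s w → let q = foldl step start p in Accepting q s → Loop q w → 1 ℕ.≤ length w →
      ∀ fuel l → length l ℕ.≤ fuel → Loop q l → ∃[ k ] ∃[ r ] (l ≡ power w k ++ r × length r ℕ.≤ length w)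
    loop-decompose p s w acc w-loop w≥1 fuel l l≤ l-loop with length w ℕP.≤? length l
    ... | no w≰l = 0 , l , refl , ℕP.<⇒≤ (ℕP.≰⇒> w≰l)
    loop-decompose p s w acc w-loop w≥1 zero       l l≤ l-loop | yes w≤l = contradiction (ℕP.≤-trans w≥1 (ℕP.≤-trans w≤l l≤)) λ ()
    loop-decompose p s w acc w-loop w≥1 (suc fuel) l l≤ l-loop | yes w≤l
      with prefix-of w l (loops-unique p s (l ++ w) (w ++ l) acc (trans (loop-++ l l-loop) w-loop) (trans (loop-++ w w-loop) l-loop)
             (trans (ListP.length-++ l) (trans (ℕP.+-comm (length l) (length w)) (sym (ListP.length-++ w))))) w≤l
    ... | l′ , refl with loop-decompose p s w acc w-loop w≥1 fuel l′
             (ℕP.≤-pred (ℕP.≤-trans (ℕP.+-monoˡ-≤ (length l′) w≥1) (subst (ℕ._≤ suc fuel) (ListP.length-++ w) l≤)))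
             (trans (sym (loop-++ w w-loop)) l-loop)
    ...   | k , r , refl , r≤ = suc k , r , sym (ListP.++-assoc w (power w k) r) , r≤

-- Covering by families

·-distribˡ : ∀ {m} c (x y : Point m) → c · (x ⊕ y) ≡ (c · x) ⊕ (c · y)
·-distribˡ c []       []       = refl
·-distribˡ c (x ∷ xs) (y ∷ ys) = cong₂ _∷_ (ℤP.*-distribˡ-+ c x y) (·-distribˡ c xs ys)

·-𝟘 : ∀ {m} c → c · 𝟘 {m} ≡ 𝟘
·-𝟘 {zero}  c = refl
·-𝟘 {suc m} c = cong₂ _∷_ (ℤP.*-zeroʳ c) (·-𝟘 c)

val-++ : ∀ {d m} (u w : Word d m) → val (u ++ w) ≡ val u ⊕ ((+ (d ℕ.^ length u)) · val w)
val-++ {d} []      w = trans (e (val w)) (sym (⊕-identityˡ _))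
  where
  e : ∀ {m} (x : Point m) → x ≡ (+ 1) · x
  e []       = refl
  e (x ∷ xs) = cong₂ _∷_ (sym (ℤP.*-identityˡ x)) (e xs)
val-++ {d} (ℓ ∷ u) w = begin
  value ℓ ⊕ ((+ d) · val (u ++ w))                           ≡⟨ cong (λ x → value ℓ ⊕ ((+ d) · x)) (val-++ u w) ⟩
  value ℓ ⊕ ((+ d) · (val u ⊕ (p · val w)))                  ≡⟨ cong (value ℓ ⊕_) (·-distribˡ (+ d) (val u) (p · val w)) ⟩
  value ℓ ⊕ (((+ d) · val u) ⊕ ((+ d) · (p · val w)))        ≡⟨ ⊕-assoc (value ℓ) _ _ ⟨
  val (ℓ ∷ u) ⊕ ((+ d) · (p · val w))                        ≡⟨ cong (val (ℓ ∷ u) ⊕_) (·-· (+ d) p (val w)) ⟨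
  val (ℓ ∷ u) ⊕ ((+ d * p) · val w)                          ≡⟨ cong (λ k → val (ℓ ∷ u) ⊕ (k · val w)) (ℤP.pos-* d (d ℕ.^ length u)) ⟨
  val (ℓ ∷ u) ⊕ ((+ (d ℕ.^ length (ℓ ∷ u))) · val w)         ∎
  where
  open ≡-Reasoning
  p = + (d ℕ.^ length u)

module _ (d : ℕ) .{{_ : NonZero d}} (δ′ L : ℕ) {m : ℕ} where

  private
    D : ℤ
    D = + (d ℕ.^ suc δ′)
    ev : List (Point m × ℕ) → Point m
    ev = place-sum d δ′ L
    R = rep d δ′ L
    P = pow d δ′ L

  val-power : ∀ (w : Word d m) n {w′} → length w ≡ suc δ′ →
    val (power w n ++ w′) ≡ (repunit d δ′ n · val w) ⊕ ((D ℤ.^ n) · val w′)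
  val-power w zero    {w′} len = e (val w) (val w′)
    where
    e : ∀ {m} (v x : Point m) → x ≡ ((+ 0) · v) ⊕ ((+ 1) · x)
    e []       []       = refl
    e (v ∷ vs) (x ∷ xs) = cong₂ _∷_ (sym (trans (ℤP.+-identityˡ (+ 1 * x)) (ℤP.*-identityˡ x))) (e vs xs)
  val-power w (suc n) {w′} len = begin
    val ((w ++ power w n) ++ w′)                       ≡⟨ cong val (ListP.++-assoc w (power w n) w′) ⟩
    val (w ++ power w n ++ w′)                         ≡⟨ val-++ w (power w n ++ w′) ⟩
    val w ⊕ ((+ (d ℕ.^ length w)) · val (power w n ++ w′)) ≡⟨ cong₂ (λ k x → val w ⊕ ((+ (d ℕ.^ k)) · x)) len (val-power w n len) ⟩
    val w ⊕ (D · ((r · val w) ⊕ (p · val w′)))         ≡⟨ e D r p (val w) (val w′) ⟩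
    ((+ 1 + D * r) · val w) ⊕ ((D * p) · val w′)       ∎
    where
    open ≡-Reasoning
    r = repunit d δ′ n
    p = D ℤ.^ n
    e : ∀ {m} D r p (v x : Point m) → v ⊕ (D · ((r · v) ⊕ (p · x))) ≡ ((+ 1 + D * r) · v) ⊕ ((D * p) · x)
    e D r p []       []       = refl
    e D r p (v ∷ vs) (x ∷ xs) = cong₂ _∷_ (eℤ D r p v x) (e D r p vs xs)
      where
      eℤ : ∀ D r p v x → v + D * (r * v + p * x) ≡ (+ 1 + D * r) * v + (D * p) * x
      eℤ = solve-∀

  ^-repunit : ∀ n → D ℤ.^ n ≡ + 1 + (D + - + 1) * repunit d δ′ n
  ^-repunit zero    = cong (_+_ (+ 1)) (sym (ℤP.*-zeroʳ (D + - + 1)))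
  ^-repunit (suc n) = trans (cong (D *_) (^-repunit n)) (e D (repunit d δ′ n))
    where
    e : ∀ D r → D * (+ 1 + (D + - + 1) * r) ≡ + 1 + (D + - + 1) * (+ 1 + D * r)
    e = solve-∀

  prepend-letter : Letter d m → Family d δ′ L → Family d δ′ L
  prepend-letter ℓ (t , as) = value ℓ ⊕ ((+ d) · t) , List.map ((+ d) ·_) as

  InFamily-letter : ∀ ℓ F {x} → InFamily d δ′ L F x → InFamily d δ′ L (prepend-letter ℓ F) (value ℓ ⊕ ((+ d) · x))
  InFamily-letter ℓ (t , as) (ps , refl , qs , refl) = List.map (Prod.map₁ ((+ d) ·_)) ps ,
    trans (sym (ListP.map-∘ ps)) (ListP.map-∘ ps) , AllP.map⁺ qs , (begin
      value ℓ ⊕ ((+ d) · (t ⊕ ev ps))                ≡⟨ cong (value ℓ ⊕_) (·-distribˡ (+ d) t (ev ps)) ⟩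
      value ℓ ⊕ (((+ d) · t) ⊕ ((+ d) · ev ps))      ≡⟨ ⊕-assoc (value ℓ) _ _ ⟨
      (value ℓ ⊕ ((+ d) · t)) ⊕ ((+ d) · ev ps)      ≡⟨ cong ((value ℓ ⊕ ((+ d) · t)) ⊕_) (scale ps) ⟩
      (value ℓ ⊕ ((+ d) · t)) ⊕ ev (List.map (Prod.map₁ ((+ d) ·_)) ps) ∎)
    where
    open ≡-Reasoning
    scale : ∀ ps → (+ d) · ev ps ≡ ev (List.map (Prod.map₁ ((+ d) ·_)) ps)
    scale []             = ·-𝟘 (+ d)
    scale ((a , p) ∷ ps) = trans (·-distribˡ (+ d) (R p · a) (ev ps)) (cong₂ _⊕_
      (trans (sym (·-· (+ d) (R p) a)) (trans (cong (_· a) (ℤP.*-comm (+ d) (R p))) (·-· (R p) (+ d) a))) (scale ps))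

  prepend-word : Word d m → Family d δ′ L → Family d δ′ L
  prepend-word r F = List.foldr prepend-letter F r

  InFamily-word : ∀ r F {w} → InFamily d δ′ L F (val w) → InFamily d δ′ L (prepend-word r F) (val (r ++ w))
  InFamily-word []      F i = i
  InFamily-word (ℓ ∷ r) F i = InFamily-letter ℓ (prepend-word r F) (InFamily-word r F i)

  -- The old coefficients stay as they are, with places now counted from the start of the longer
  -- word. This adds R(k) times each of them, which the term with `sumP as` in the new coefficient
  -- takes back.
  prepend-power : Word d m → Family d δ′ L → Family d δ′ L
  prepend-power w (t , as) = t , (val w ⊕ (((D + - + 1) · t) ⊕ ((- + 1) · sumP as))) ∷ as

  place-sum-shift : ∀ k ps → ev (List.map (Prod.map₂ (k ℕ.+_)) ps) ≡ (R k · sumP (coefficients ps)) ⊕ (P k · ev ps)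
  place-sum-shift k []             = sym (trans (cong₂ _⊕_ (·-𝟘 (R k)) (·-𝟘 (P k))) (⊕-identityˡ 𝟘))
  place-sum-shift k ((a , p) ∷ ps) = trans (cong₂ (λ r x → (r · a) ⊕ x) (rep-+ d δ′ L k p) (place-sum-shift k ps))
    (e (R k) (P k) (R p) a (sumP (coefficients ps)) (ev ps))
    where
    e : ∀ {m} r p q (a s x : Point m) → ((r + p * q) · a) ⊕ ((r · s) ⊕ (p · x)) ≡ (r · (a ⊕ s)) ⊕ (p · ((q · a) ⊕ x))
    e r p q []       []       []       = refl
    e r p q (a ∷ as) (s ∷ ss) (x ∷ xs) = cong₂ _∷_ (eℤ r p q a s x) (e r p q as ss xs)
      where
      eℤ : ∀ r p q a s x → (r + p * q) * a + (r * s + p * x) ≡ r * (a + s) + p * (q * a + x)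
      eℤ = solve-∀

  -- Dᵏ(t + ∑ aᵢ R(nᵢ)) = t + ((D-1)t - ∑ aᵢ) R(k) + ∑ aᵢ R(k+nᵢ), since Dᵏ = 1 + (D-1)R(k).
  InFamily-power : ∀ w k F {x} → InFamily d δ′ L F x →
    InFamily d δ′ L (prepend-power w F) ((R (suc k) · val w) ⊕ (P (suc k) · x))
  InFamily-power w k (t , as) (ps , refl , qs , refl) = (_ , suc k) ∷ List.map (Prod.map₂ (suc k ℕ.+_)) ps ,
    cong (_ ∷_) (sym (ListP.map-∘ ps)) , s≤s z≤n ∷ AllP.map⁺ (All.map (λ _ → s≤s z≤n) qs) ,
    trans (cong (λ p → (R (suc k) · val w) ⊕ (p · (t ⊕ ev ps))) (^-repunit (L ℕ.* suc k)))
    (trans (e D (R (suc k)) (val w) t (sumP (coefficients ps)) (ev ps))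
    (cong (λ x → t ⊕ ((R (suc k) · (val w ⊕ (((D + - + 1) · t) ⊕ ((- + 1) · sumP as)))) ⊕ x))
      (trans (cong (λ p → (R (suc k) · sumP (coefficients ps)) ⊕ (p · ev ps)) (sym (^-repunit (L ℕ.* suc k)))) (sym (place-sum-shift (suc k) ps)))))
    where
    e : ∀ {m} D r (v t s x : Point m) → (r · v) ⊕ ((+ 1 + (D + - + 1) * r) · (t ⊕ x))
      ≡ t ⊕ ((r · (v ⊕ (((D + - + 1) · t) ⊕ ((- + 1) · s)))) ⊕ ((r · s) ⊕ ((+ 1 + (D + - + 1) * r) · x)))
    e D r []       []       []       []       = refl
    e D r (v ∷ vs) (t ∷ ts) (s ∷ ss) (x ∷ xs) = cong₂ _∷_ (eℤ D r v t s x) (e D r vs ts ss xs)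
      where
      eℤ : ∀ D r v t s x → r * v + (+ 1 + (D + - + 1) * r) * (t + x)
         ≡ t + (r * (v + ((D + - + 1) * t + - + 1 * s)) + (r * s + (+ 1 + (D + - + 1) * r) * x))
      eℤ = solve-∀

module Cover (d : ℕ) .{{_ : NonZero d}} (δ′ L : ℕ) (1≤L : 1 ℕ.≤ L) {m : ℕ} (M : DFA d m)
  (divisible : ∀ {k} → 1 ℕ.≤ k → k ℕ.≤ DFA.nStates M → k ∣ suc δ′)
  (c e : ℕ) (bounded : ∀ k ws → Unique ws → All (λ w → Loops.Accepting M (DFA.start M) w × length w ℕ.≤ k) ws →
                       length ws ℕ.≤ c ℕ.* suc k ℕ.^ e) where

  open DFA M
  open Loops M

  private
    N = nStates
    δ = suc δ′

  powered : ∀ {q} → LoopSearch δ q → List (Family d δ′ L) → List (Family d δ′ L)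
  powered (inj₁ (w , _)) Fs = List.map (prepend-power d δ′ L w) Fs
  powered (inj₂ _)       Fs = []

  -- The number bounds how many states may still be visited; it drops at each letter that leaves a
  -- state for good, so the recursion ends although words are unbounded.
  cover : ℕ → Fin N → List (Family d δ′ L)

  cover-after : ℕ → Fin N → List (Family d δ′ L)
  cover-after k q = (𝟘 , []) ∷ concatMap (λ ℓ → List.map (prepend-letter d δ′ L ℓ) (cover k (step q ℓ))) (letters m)

  -- The bound is the length of `power u L`, which limits the remainder left by `loop-decompose`.
  -- All words up to this length are listed, as a cover may be too large.
  cover-remainder : ℕ → Fin N → List (Family d δ′ L)
  cover-remainder k q = concatMap (λ r → List.map (prepend-word d δ′ L r) (cover-after k q)) (words m (L ℕ.* δ))

  cover zero    q = []
  cover (suc k) q = cover-remainder k q ++ powered (loop-search divisible q) (cover-remainder k q)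

  Covered : List (Family d δ′ L) → Word d m → Set
  Covered Fs w = ∃[ F ] (F ∈ Fs × InFamily d δ′ L F (val w))

  covered-remainder : ∀ k q r w → length r ℕ.≤ L ℕ.* δ → Covered (cover-after k q) w → Covered (cover-remainder k q) (r ++ w)
  covered-remainder k q r w r≤ (F , F∈ , i) = prepend-word d δ′ L r F ,
    ∈-concatMap _ (∈-words (L ℕ.* δ) r r≤) (∈P.∈-map⁺ _ F∈) , InFamily-word d δ′ L r F i

  covered-loop : ∀ k p l w → let q = foldl step start p in Loop q l → Accepting q w → Covered (cover-after k q) w →
    (search : LoopSearch δ q) → Covered (cover-remainder k q ++ powered search (cover-remainder k q)) (l ++ w)
  covered-loop k p l w l-loop acc covered (inj₂ none) with none l l-loop
  ... | refl = let F , F∈ , i = covered-remainder k q [] w z≤n covered in F , ∈P.∈-++⁺ˡ F∈ , i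
    where q = foldl step start p
  covered-loop k p l w l-loop acc covered (inj₁ (u , u≡δ , u-loop))
    -- Splitting by the `L`-th power of `u` makes the exponent of `u` a multiple of `L`, as the form
    -- of the families demands.
    with loop-decompose c e bounded p w (power u L) acc (loop-power u u-loop L)
           (subst (1 ℕ.≤_) (sym length-uᴸ) (ℕP.*-mono-≤ 1≤L (s≤s z≤n))) (length l) l ℕP.≤-refl l-loop
    where
    length-uᴸ : length (power u L) ≡ L ℕ.* δ
    length-uᴸ = trans (length-power u L) (cong (L ℕ.*_) u≡δ)
  ... | j , r , refl , r≤ = powers j
    where
    q = foldl step start p
    rest = covered-remainder k q r w (ℕP.≤-trans r≤ (ℕP.≤-reflexive (trans (length-power u L) (cong (L ℕ.*_) u≡δ)))) covered
    powers : ∀ j → Covered (cover-remainder k q ++ powered (inj₁ (u , u≡δ , u-loop)) (cover-remainder k q)) ((power (power u L) j ++ r) ++ w)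
    -- Exponent 0 is left out by `prepend-power`, whose new parameter starts at 1; the remainder
    -- families account for it.
    powers zero    = let F , F∈ , i = rest in F , ∈P.∈-++⁺ˡ F∈ , i
    powers (suc j) = let F , F∈ , i = rest in prepend-power d δ′ L u F ,
      ∈P.∈-++⁺ʳ (cover-remainder k q) (∈P.∈-map⁺ (prepend-power d δ′ L u) F∈) ,
      subst (InFamily d δ′ L (prepend-power d δ′ L u F)) (sym value≡) (InFamily-power d δ′ L u j F i)
      where
      value≡ : val ((power (power u L) (suc j) ++ r) ++ w) ≡ (rep d δ′ L (suc j) · val u) ⊕ (pow d δ′ L (suc j) · val (r ++ w))
      value≡ = trans (cong val (trans (ListP.++-assoc (power (power u L) (suc j)) r w) (cong (_++ (r ++ w)) (power-* u L (suc j)))))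
        (val-power d δ′ L u (L ℕ.* suc j) u≡δ)

  -- `V` holds the states already left for good. The current state is given through a word `p`
  -- leading to it because uniqueness of loops needs a state that is reachable, and acceptance of
  -- `w` supplies the other half of usefulness.
  cover-correct : ∀ k V p w → let q = foldl step start p in Unique V → N ℕ.≤ length V ℕ.+ k → Avoids V q w →
    Accepting q w → Covered (cover k q) w
  cover-after-correct : ∀ k V p w → let q = foldl step start p in Unique V → N ℕ.≤ length V ℕ.+ k → AvoidsAfter V q w →
    Accepting q w → Covered (cover-after k q) w

  cover-after-correct k V p []      uniq V≥ av acc = (𝟘 , []) , here refl , [] , refl , [] , sym (⊕-identityˡ 𝟘)
  cover-after-correct k V p (ℓ ∷ w) uniq V≥ av acc =
    let q = foldl step start p
        q≡ = ListP.foldl-++ step start p (ℓ ∷ [])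
        F , F∈ , i = subst (λ q → Covered (cover k q) w) q≡ (cover-correct k V (p ++ ℓ ∷ []) w uniq V≥
          (subst (λ q → Avoids V q w) (sym q≡) av) (subst (λ q → Accepting q w) (sym q≡) acc))
    in prepend-letter d δ′ L ℓ F , there (∈-concatMap (λ ℓ → List.map (prepend-letter d δ′ L ℓ) (cover k (step q ℓ))) (∈-letters ℓ) (∈P.∈-map⁺ _ F∈)) ,
       InFamily-letter d δ′ L ℓ F i

  -- Here `V` exhausts the states, yet the current state lies outside of it.
  cover-correct zero    V p w uniq V≥ av acc = contradiction
    (Unique-length (AllP.¬Any⇒All¬ V (avoids-head w av) ∷ uniq)) (ℕP.<⇒≱ (s≤s (ℕP.≤-trans V≥ (ℕP.≤-reflexive (ℕP.+-identityʳ _)))))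
  cover-correct (suc k) V p w uniq V≥ av acc with last-visit (foldl step start p) V (foldl step start p) w av
  ... | inj₂ av′ = contradiction (here refl) (avoids-head w av′)
  ... | inj₁ (l , w′ , refl , l-loop , av′) = covered-loop k p l w′ l-loop acc′
        (cover-after-correct k (_ ∷ V) p w′ (AllP.¬Any⇒All¬ V (avoids-head (l ++ w′) av) ∷ uniq)
          (ℕP.≤-trans V≥ (ℕP.≤-reflexive (ℕP.+-suc (length V) k))) av′ acc′)
        (loop-search divisible (foldl step start p))
    where
    acc′ = trans (cong accept (sym (loop-++ l l-loop))) acc

open import Data.Nat using (_≤_)

theorem3p1 : (d m : ℕ) → .{{_ : NonZero d}} → 2 ≤ d → 1 ≤ m →
    (A : Subset m) → DSparse d A → StableIn A →
    ∃[ e ] (∀ x → (A x → ⟦ e ⟧ d x) × (⟦ e ⟧ d x → A x))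
theorem3p1 d m 2≤d _ A ((M , regular) , c , e , polynomial) stable =
  let E , in-E , E⊆ = union-of d 2≤d M δ′ A A⇒acc acc⇒A stable (cover N start)
        (λ {F} _ → family-combination d 2≤d M δ′ A A⇒acc acc⇒A stable _ F ℕP.≤-refl)
  in E , λ x → (λ x∈A → let F , F∈ , i = cover-correct N [] [] (canon d x) [] ℕP.≤-refl (avoids-none start (canon d x)) (A⇒acc x x∈A)
                        in in-E F∈ x (subst (InFamily d δ′ L F) (val-canon d 2≤d x) i) (A⇒acc x x∈A)) ,
               (λ x∈E → acc⇒A x (E⊆ x x∈E))
  where
  open DFA M
  N = nStates
  -- One factorial serves as both δ and `L`: it is also divisible by all loop lengths up to N,
  -- because N ≤ N².
  L = (N ℕ.* N) !
  δ′ = ℕ.pred L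
  1≤L : 1 ℕ.≤ L
  1≤L = ℕP.1≤n! (N ℕ.* N)
  A⇒acc : ∀ x → A x → accepts d 2≤d M x ≡ true
  A⇒acc x x∈A = proj₁ (regular (canon d x)) (x , x∈A , refl)
  acc⇒A : ∀ x → accepts d 2≤d M x ≡ true → A x
  acc⇒A x acc with proj₂ (regular (canon d x)) acc
  -- Regularity only provides some `y` in `A` with the same word as `x`; taking values of the words
  -- identifies the two.
  ... | y , y∈A , eq = subst A (trans (sym (val-canon d 2≤d y)) (trans (cong val eq) (val-canon d 2≤d x))) y∈A
  divisible : ∀ {k} → 1 ℕ.≤ k → k ℕ.≤ N → k ∣ suc δ′
  divisible {k} k≥1 k≤N = subst (k ∣_) (sym (ℕP.suc-pred L {{ℕ.>-nonZero 1≤L}}))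
    (∣-! k≥1 (ℕP.≤-trans k≤N (ℕP.m≤n*m N N {{ℕ.>-nonZero (ℕP.≤-trans k≥1 k≤N)}})))
  bounded : ∀ k ws → Unique ws → All (λ w → Loops.Accepting M start w × length w ℕ.≤ k) ws → length ws ℕ.≤ c ℕ.* suc k ℕ.^ e
  bounded k ws uniq acc = polynomial k ws uniq (All.map (λ {w} → Prod.map₁ (proj₂ (regular w))) acc)
  open Cover d δ′ L 1≤L M divisible c e bounded
  open Loops M
  avoids-none : ∀ q w → Avoids [] q w
  avoids-none q []      = λ ()
  avoids-none q (ℓ ∷ w) = (λ ()) , avoids-none (step q ℓ) w
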